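{- For all integers $n \geq 0$, $$dp(27n+7) \equiv dp(3n+1) \pmod{3}.$$
   Context: A partition of a positive integer $n$ is a nonincreasing sequence of positive integers (called parts) whose sum is $n$. For $n\ge 0$, $dp(n)$ denotes the number of partitions of $n$ in which every part is either divisible by $4$ or congruent to $\pm 1 \pmod 6$ (with $dp(0)=1$). Equivalently, its generating function is $$\sum_{n=0}^{\infty} dp(n)q^n = \frac{1}{(q;q^6)_\infty (q^5;q^6)_\infty (q^4;q^4)_\infty},$$ where $(a;q)_\infty := (1-a)(1-aq)(1-aq^2)\cdots$. -}

module Defs where

open import Data.List.Base
  using (List; []; _∷_; _++_; map; concatMap; filter; length; replicate; upTo)
open import Data.List.Membership.Propositional using (_∈_; find; lose)
open import Data.List.Membership.Propositional.Properties
  using (∈-concatMap⁺; ∈-concatMap⁻; ∈-map⁺; ∈-map⁻; ∈-upTo⁺; ∈-upTo⁻; ∈-filter⁺; ∈-filter⁻)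
open import Data.List.Properties using (++-cancelˡ; ∷-injectiveʳ)
open import Data.List.Relation.Binary.Disjoint.Propositional using (Disjoint)
open import Data.List.Relation.Unary.All as All using (All; []; _∷_; all?)
import Data.List.Relation.Unary.All.Properties as Allₚ
open import Data.List.Relation.Unary.AllPairs as AllPairs using (AllPairs; []; _∷_)
import Data.List.Relation.Unary.AllPairs.Properties as AllPairsₚ
open import Data.List.Relation.Unary.Any using (here)
open import Data.List.Relation.Unary.Linked using (Linked)
open import Data.List.Relation.Unary.Linked.Properties using (Linked⇒AllPairs; AllPairs⇒Linked)
open import Data.List.Relation.Unary.Unique.Propositional using (Unique)
import Data.List.Relation.Unary.Unique.Propositional.Properties as Uniqueₚ
open import Data.Nat.Base
open import Data.Nat.Divisibility using (_∣_; _∣?_)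
open import Data.Nat.DivMod using (m/n*n≤m; m*n/n≡m; /-monoˡ-≤)
open import Data.Nat.ListAction using (sum)
open import Data.Nat.ListAction.Properties using (sum-++)
open import Data.Nat.Properties
open import Data.Product.Base using (∃-syntax; _×_; _,_)
open import Data.Sum.Base using (_⊎_; inj₁; inj₂)
open import Function.Base using (flip)
open import Function.Bundles using (_⇔_; mk⇔; Equivalence)
open import Relation.Binary.PropositionalEquality
open import Relation.Nullary.Decidable using (Dec; _⊎-dec_)
open import Relation.Nullary.Negation using (contradiction)

record IsPartition (n : ℕ) (ps : List ℕ) : Set where
  field
    positive      : All (1 ≤_) ps
    nonincreasing : Linked _≥_ ps
    total         : sum ps ≡ n

AllowedPart : ℕ → Set
AllowedPart p = 4 ∣ p ⊎ p % 6 ≡ 1 ⊎ p % 6 ≡ 5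

allowedPart? : ∀ p → Dec (AllowedPart p)
allowedPart? p = (4 ∣? p) ⊎-dec (p % 6 ≟ 1) ⊎-dec (p % 6 ≟ 5)

-- The partitions of n with all parts at most k, grouped by the multiplicity m
-- (possibly 0) of the part k.
partitionsUpTo : ℕ → ℕ → List (List ℕ)
partitionsUpTo zero    zero    = [] ∷ []
partitionsUpTo zero    (suc n) = []
partitionsUpTo (suc k) n       =
  concatMap (λ m → map (replicate m (suc k) ++_) (partitionsUpTo k (n ∸ m * suc k)))
            (upTo (suc (n / suc k)))

partitions : ℕ → List (List ℕ)
partitions n = partitionsUpTo n n

dpPartitions : ℕ → List (List ℕ)
dpPartitions n = filter (all? allowedPart?) (partitions n)

-- This is the cardinality of the set of partitions in question, because
-- dpPartitions lists each of them exactly once: see ∈-dpPartitions and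
-- dpPartitions-unique below.
dp : ℕ → ℕ
dp n = length (dpPartitions n)

private
  sum-replicate : ∀ m x → sum (replicate m x) ≡ m * x
  sum-replicate zero    x = refl
  sum-replicate (suc m) x = cong (x +_) (sum-replicate m x)

  nonincreasing-replicate++ : ∀ m {x ys} → All (_≤ x) ys → AllPairs _≥_ ys →
                              AllPairs _≥_ (replicate m x ++ ys)
  nonincreasing-replicate++ zero    _  qs = qs
  nonincreasing-replicate++ (suc m) bs qs =
    Allₚ.++⁺ (Allₚ.replicate⁺ m ≤-refl) bs ∷ nonincreasing-replicate++ m bs qs

  record IsPartitionUpTo (k n : ℕ) (ps : List ℕ) : Set where
    constructor mk
    field
      pos   : All (1 ≤_) ps
      dec   : AllPairs _≥_ ps
      tot   : sum ps ≡ n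
      bound : All (_≤ k) ps

  sound : ∀ k n {ps} → ps ∈ partitionsUpTo k n → IsPartitionUpTo k n ps
  sound zero zero (here refl) = mk [] [] refl []
  sound (suc k) n ps∈
    with m , m∈ , ps∈ₘ ← find (∈-concatMap⁻ _ {xs = upTo (suc (n / suc k))} ps∈)
    with qs , qs∈ , refl ← ∈-map⁻ _ ps∈ₘ
    with mk p d t b ← sound k (n ∸ m * suc k) qs∈
    = mk (Allₚ.++⁺ (Allₚ.replicate⁺ m (s≤s z≤n)) p)
         (nonincreasing-replicate++ m b′ d)
         eq
         (Allₚ.++⁺ (Allₚ.replicate⁺ m ≤-refl) b′)
    where
    b′ = All.map m≤n⇒m≤1+n b
    le : m * suc k ≤ n
    le = ≤-trans (*-monoˡ-≤ (suc k) (≤-pred (∈-upTo⁻ m∈))) (m/n*n≤m n (suc k))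
    eq : sum (replicate m (suc k) ++ qs) ≡ n
    eq = trans (sum-++ (replicate m (suc k)) qs)
               (trans (cong₂ _+_ (sum-replicate m (suc k)) t) (m+[n∸m]≡n le))

  split : ∀ k ps → AllPairs _≥_ ps → All (_≤ suc k) ps →
          ∃[ m ] ∃[ qs ] ps ≡ replicate m (suc k) ++ qs × All (_≤ k) qs
  split k []       _        _        = 0 , [] , refl , []
  split k (p ∷ ps) (d ∷ ds) (b ∷ bs) with m≤n⇒m<n∨m≡n b
  ... | inj₁ (s≤s p≤k) = 0 , p ∷ ps , refl , p≤k ∷ All.map (λ q≤p → ≤-trans q≤p p≤k) d
  ... | inj₂ refl with m , qs , refl , bs′ ← split k ps ds bs = suc m , qs , refl , bs′

  AllPairs-++⁻ʳ : ∀ xs {ys : List ℕ} → AllPairs _≥_ (xs ++ ys) → AllPairs _≥_ ys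
  AllPairs-++⁻ʳ []       qs       = qs
  AllPairs-++⁻ʳ (x ∷ xs) (_ ∷ qs) = AllPairs-++⁻ʳ xs qs

  complete : ∀ k n {ps} → IsPartitionUpTo k n ps → ps ∈ partitionsUpTo k n
  complete zero n {[]}     (mk _ _ refl _)                = here refl
  complete zero n {p ∷ ps} (mk (1≤p ∷ _) _ _ (p≤0 ∷ _)) = contradiction (≤-trans 1≤p p≤0) λ ()
  complete (suc k) n {ps} (mk p d t b)
    with m , qs , refl , b′ ← split k ps d b
    = ∈-concatMap⁺ _ (lose (∈-upTo⁺ (s≤s m≤)) (∈-map⁺ _ (complete k _
        (mk (Allₚ.++⁻ʳ (replicate m (suc k)) p) (AllPairs-++⁻ʳ (replicate m (suc k)) d) sum-qs b′))))
    where
    eq : m * suc k + sum qs ≡ n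
    eq = trans (sym (trans (sum-++ (replicate m (suc k)) qs)
                           (cong (_+ sum qs) (sum-replicate m (suc k))))) t
    m≤ : m ≤ n / suc k
    m≤ = subst (_≤ n / suc k) (m*n/n≡m m (suc k))
               (/-monoˡ-≤ (suc k) (subst (m * suc k ≤_) eq (m≤m+n _ _)))
    sum-qs : sum qs ≡ n ∸ m * suc k
    sum-qs = trans (sym (m+n∸m≡n (m * suc k) (sum qs))) (cong (_∸ m * suc k) eq)

  multiplicity-injective : ∀ {k} m m′ {qs qs′} → All (_≤ k) qs → All (_≤ k) qs′ →
    replicate m (suc k) ++ qs ≡ replicate m′ (suc k) ++ qs′ → m ≡ m′
  multiplicity-injective zero    zero     _        _        _    = refl
  multiplicity-injective zero    (suc m′) (b ∷ _)  _        refl = contradiction b 1+n≰n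
  multiplicity-injective (suc m) zero     _        (b ∷ _)  refl = contradiction b 1+n≰n
  multiplicity-injective (suc m) (suc m′) bs       bs′      eq   =
    cong suc (multiplicity-injective m m′ bs bs′ (∷-injectiveʳ eq))

  unique : ∀ k n → Unique (partitionsUpTo k n)
  unique zero    zero    = [] ∷ []
  unique zero    (suc n) = []
  unique (suc k) n       = Uniqueₚ.concat⁺
    (Allₚ.map⁺ (All.universal
      (λ m → Uniqueₚ.map⁺ (++-cancelˡ (replicate m (suc k)) _ _) (unique k (n ∸ m * suc k))) _))
    (AllPairsₚ.map⁺ (AllPairs.map disjoint (Uniqueₚ.upTo⁺ (suc (n / suc k)))))
    where
    disjoint : ∀ {m m′} → m ≢ m′ →
      Disjoint (map (replicate m (suc k) ++_) (partitionsUpTo k (n ∸ m * suc k)))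
               (map (replicate m′ (suc k) ++_) (partitionsUpTo k (n ∸ m′ * suc k)))
    disjoint {m} {m′} m≢m′ (∈₁ , ∈₂)
      with qs  , qs∈  , refl ← ∈-map⁻ _ ∈₁
      with qs′ , qs′∈ , eq   ← ∈-map⁻ _ ∈₂
      = m≢m′ (multiplicity-injective m m′
               (IsPartitionUpTo.bound (sound k _ qs∈)) (IsPartitionUpTo.bound (sound k _ qs′∈)) eq)

  parts≤sum : ∀ ps → All (_≤ sum ps) ps
  parts≤sum []       = []
  parts≤sum (p ∷ ps) =
    m≤m+n p (sum ps) ∷ All.map (λ q≤ → ≤-trans q≤ (m≤n+m (sum ps) p)) (parts≤sum ps)

∈-partitions : ∀ {n ps} → ps ∈ partitions n ⇔ IsPartition n ps
∈-partitions {n} {ps} = mk⇔ to from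
  where
  to : ps ∈ partitions n → IsPartition n ps
  to ps∈ with mk p d t _ ← sound n n ps∈ =
    record { positive = p ; nonincreasing = AllPairs⇒Linked d ; total = t }
  from : IsPartition n ps → ps ∈ partitions n
  from record { positive = p ; nonincreasing = d ; total = t } = complete n n
    (mk p (Linked⇒AllPairs (flip ≤-trans) d) t (subst (λ s → All (_≤ s) ps) t (parts≤sum ps)))

∈-dpPartitions : ∀ {n ps} → ps ∈ dpPartitions n ⇔ (IsPartition n ps × All AllowedPart ps)
∈-dpPartitions {n} = mk⇔
  (λ ps∈ → let ps∈′ , allowed = ∈-filter⁻ (all? allowedPart?) {xs = partitions n} ps∈
            in Equivalence.to ∈-partitions ps∈′ , allowed)
  (λ (isP , allowed) → ∈-filter⁺ (all? allowedPart?) (Equivalence.from ∈-partitions isP) allowed)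

dpPartitions-unique : ∀ n → Unique (dpPartitions n)
dpPartitions-unique n = Uniqueₚ.filter⁺ (all? allowedPart?) (unique n n)

{-# OPTIONS --safe #-}

-- Modulo 3, the generating function of dp is ψ(−q)² / (q¹²; q¹²)_∞, where ψ(q) = Σ_{n ≥ 0} q^{n(n+1)/2}.
-- Let φ(q) = Σ_{n ∈ ℤ} q^{n²} and A(q) = Σ_{n ∈ ℤ} q^{n(3n+1)/2}. From ψ(q) = A(q³) + q ψ(q⁹) one reads off
-- the terms with exponent 3n + 1, and the Jacobi triple product turns the result into
--   Σ dp(3n+1) qⁿ ≡ ψ(q)² φ(−q⁶)  (mod 3).
-- By the same dissection of ψ, the terms of ψ(q)² φ(−q⁶) with exponent 3n + 2 form the series ψ(q³)² φ(−q²), and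
-- the terms of that one with exponent 3n give back ψ(q)² φ(−q⁶). Finally 27n + 7 = 3 (3 (3n) + 2) + 1.
-- Infinite sums and products are replaced by finite ones in the rings of power series modulo q^N, in which
-- 1 + x can be cancelled whenever x is a multiple of q.

module Submission where

open import Defs
open import Algebra.Bundles using (CommutativeMonoid; CommutativeRing)
open import Algebra.Morphism.Structures using (IsRingHomomorphism)
import Algebra.Properties.CommutativeSemigroup as CommutativeSemigroupProperties
import Algebra.Properties.CommutativeSemiring.Exp as Exp
import Algebra.Properties.Group as GroupProperties
import Algebra.Properties.Ring as RingProperties
import Algebra.Solver.Ring.NaturalCoefficients.Default as NaturalCoefficients
open import Data.Bool.Base using (true; false; if_then_else_)
open import Data.Fin.Base using (Fin; zero; suc; toℕ)
open import Data.Fin.Properties using (toℕ-fromℕ<; toℕ-injective)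
  renaming (_≟_ to _≟ᶠ_; all? to allFin?)
open import Data.List.Base
  using (List; []; _∷_; _++_; map; concatMap; filter; length; replicate; upTo; applyUpTo)
open import Data.List.Properties
  using (filter-++; length-++; map-id; map-∘; map-concatMap; concatMap-cong; concatMap-map; ++-identityʳ; map-applyUpTo)
open import Data.List.Relation.Unary.All using (all?)
open import Data.Nat.Base as ℕ using (ℕ; zero; suc; _≤_; _<_; z≤n; s≤s; _%_)
open import Data.Nat.Divisibility using (_∣_; divides; ∣-refl; ∣m+n∣m⇒∣n; ∣m∣n⇒∣m+n; ∣n⇒∣m*n)
open import Data.Nat.DivMod
  using (_mod_; _/_; %-distribˡ-+; m<n⇒m/n≡0; [m+kn]%n≡m%n; +-distrib-/-∣ˡ; n/n≡1)
import Data.Nat.Properties as ℕₚ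
open import Data.Nat.Solver using (module +-*-Solver)
open import Data.Product.Base using (_×_; _,_; ∃-syntax)
open import Data.Sum.Base using (_⊎_; inj₁; inj₂)
open import Function.Base using (_∘_; id)
open import Level using (0ℓ)
open import Relation.Binary.PropositionalEquality as ≡ using (_≡_)
import Relation.Binary.Reasoning.Setoid as SetoidReasoning
open import Relation.Nullary.Decidable using (yes; no; does; does-≡; map′; from-yes)

-- The Jacobi triple product

-- In characteristic three cubing is a ring map, so (x; x)³ ≡ (x³; x³), and the product of 1 - qⁱ
-- over i ≡ ±1 (mod 6) is (q; q²) / (q³; q⁶) ≡ 1 / (q; q²)². Together with ψ(-q) = (q; q²) (q⁴; q⁴)
-- this is the origin of ψ(-q)². Squaring the dissection of ψ(-q) leaves the single cross term -2q
-- A(-q³) ψ(-q⁹) with exponents 3n + 1, and -2 ≡ 1. The terms with exponent 3n of φ(-q²) come from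
-- the squares of multiples of 3 only, since 2k² is 0 or 2 modulo 3. Extracting a residue class of
-- exponents from a series known modulo q^{3N} leaves one known modulo q^N, so the same series are
-- compared at several precisions. For this reason all truncated rings share their carrier and
-- operations and differ only in their equality, and one number M of terms, large enough for every
-- precision, cuts off all sums and products. Quotients of products are never formed: identities are
-- multiplied out and regular factors cancelled.

module BigOperator {c ℓ} (M : CommutativeMonoid c ℓ) where
  open CommutativeMonoid M
  open SetoidReasoning setoid
  open CommutativeSemigroupProperties commutativeSemigroup using (interchange)

  big : ℕ → (ℕ → Carrier) → Carrier
  big zero    g = ε
  big (suc n) g = big n g ∙ g n

  big-cong : ∀ n {g h} → (∀ i → g i ≈ h i) → big n g ≈ big n h
  big-cong zero    eq = refl
  big-cong (suc n) eq = ∙-cong (big-cong n eq) (eq n)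

  big-∙ : ∀ n g h → big n (λ i → g i ∙ h i) ≈ big n g ∙ big n h
  big-∙ zero    g h = sym (identityˡ ε)
  big-∙ (suc n) g h = trans (∙-congʳ (big-∙ n g h)) (interchange _ _ _ _)

  big-+ : ∀ m n g → big (m ℕ.+ n) g ≈ big n g ∙ big m (λ i → g (i ℕ.+ n))
  big-+ zero    n g = sym (identityʳ _)
  big-+ (suc m) n g = trans (∙-congʳ (big-+ m n g)) (assoc _ _ _)

  -- Writing an index as `r + i k` with `r < k` sorts a sum or product by residue classes modulo
  -- `k`. The dissections of theta series and the splittings of Pochhammer symbols all start here.
  big-blocks : ∀ n k g → big (n ℕ.* k) g ≈ big n (λ i → big k (λ r → g (r ℕ.+ i ℕ.* k)))
  big-blocks zero    k g = refl
  big-blocks (suc n) k g = trans (big-+ k (n ℕ.* k) g) (∙-congʳ (big-blocks n k g))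

  big-stable : ∀ {m n g} → m ≤ n → (∀ i → m ≤ i → g i ≈ ε) → big n g ≈ big m g
  big-stable {m} {n} {g} m≤n g≈ε =
    ≡.subst (λ k → big k g ≈ big m g) (ℕₚ.m∸n+n≡m m≤n) (go (n ℕ.∸ m))
    where
    go : ∀ k → big (k ℕ.+ m) g ≈ big m g
    go zero    = refl
    go (suc k) = trans (∙-cong (go k) (g≈ε (k ℕ.+ m) (ℕₚ.m≤n+m m k))) (identityʳ _)

-- The triangular number i (i − 1) / 2.
τ : ℕ → ℕ
τ zero    = 0
τ (suc i) = τ i ℕ.+ i

module FiniteJacobi {c ℓ} (R : CommutativeRing c ℓ) where
  open CommutativeRing R hiding (zero)
  open NaturalCoefficients commutativeSemiring using (solve; con; _:+_; _:*_; _:^_; _:=_)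
  open SetoidReasoning setoid
  open Exp commutativeSemiring
  open CommutativeSemigroupProperties *-commutativeSemigroup using (xy∙z≈xz∙y)
  open BigOperator *-commutativeMonoid public using () renaming
    (big to ∏; big-cong to ∏-cong; big-∙ to ∏-*; big-blocks to ∏-blocks; big-stable to ∏-stable)
  open BigOperator +-commutativeMonoid public using () renaming
    (big to ∑; big-cong to ∑-cong; big-∙ to ∑-+; big-blocks to ∑-blocks; big-stable to ∑-stable)

  -- The q-Pochhammer symbol (−c; p)ₙ.
  Q : ℕ → Carrier → Carrier → Carrier
  Q n c p = ∏ n (λ i → 1# + c * p ^ i)

  -- For `p = a b` this is a^{i(i+1)/2} b^{i(i-1)/2}, a term of Ramanujan's f(a, b). Exchanging `a`
  -- and `b` gives the terms of negative index.
  thetaTerm : Carrier → Carrier → ℕ → Carrier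
  thetaTerm a p i = a ^ i * p ^ τ i

  -- Both indices of `i + k = n` are handed to the summand, so that Gaussian binomials and powers
  -- `p ^ k` need no truncated subtraction.
  antidiagonal : ℕ → (ℕ → ℕ → Carrier) → Carrier
  antidiagonal zero    g = g 0 0
  antidiagonal (suc n) g = g 0 (suc n) + antidiagonal n (λ i k → g (suc i) k)

  antidiagonal-last : ∀ n g →
    antidiagonal (suc n) g ≈ antidiagonal n (λ i k → g i (suc k)) + g (suc n) 0
  antidiagonal-last zero    g = refl
  antidiagonal-last (suc n) g =
    trans (+-congˡ (antidiagonal-last n (λ i k → g (suc i) k))) (sym (+-assoc _ _ _))

  antidiagonal-cong : ∀ n {g h} → (∀ i k → i ℕ.+ k ≡ n → g i k ≈ h i k) →
                      antidiagonal n g ≈ antidiagonal n h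
  antidiagonal-cong zero    eq = eq 0 0 ≡.refl
  antidiagonal-cong (suc n) eq = +-cong (eq 0 (suc n) ≡.refl)
    (antidiagonal-cong n (λ i k i+k≡n → eq (suc i) k (≡.cong suc i+k≡n)))

  antidiagonal-+ : ∀ n g h → antidiagonal n (λ i k → g i k + h i k) ≈ antidiagonal n g + antidiagonal n h
  antidiagonal-+ zero    g h = refl
  antidiagonal-+ (suc n) g h = trans (+-congˡ (antidiagonal-+ n _ _))
    (CommutativeSemigroupProperties.interchange +-commutativeSemigroup _ _ _ _)

  antidiagonal-* : ∀ n g x → antidiagonal n (λ i k → g i k * x) ≈ antidiagonal n g * x
  antidiagonal-* zero    g x = refl
  antidiagonal-* (suc n) g x = trans (+-congˡ (antidiagonal-* n _ x)) (sym (distribʳ x _ _))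

  antidiagonal-distribʳ : ∀ n (g h x : ℕ → ℕ → Carrier) → antidiagonal n (λ i k → (g i k + h i k) * x i k) ≈
                          antidiagonal n (λ i k → g i k * x i k) + antidiagonal n (λ i k → h i k * x i k)
  antidiagonal-distribʳ n g h x =
    trans (antidiagonal-cong n (λ i k _ → distribʳ (x i k) (g i k) (h i k))) (antidiagonal-+ n _ _)

  module _ (p : Carrier) where

    -- The Gaussian binomial coefficient [i + k choose i].
    gauss : ℕ → ℕ → Carrier
    gauss zero    k       = 1#
    gauss (suc i) zero    = 1#
    gauss (suc i) (suc k) = gauss i (suc k) + p ^ suc i * gauss (suc i) k

    gauss-0 : ∀ i → gauss i 0 ≈ 1#
    gauss-0 zero    = refl
    gauss-0 (suc i) = refl

    -- The defining recurrence with the roles of `i` and `k` exchanged. Expanding both sides once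
    -- more, by induction on the left and by definition on the right, reaches the same three
    -- coefficients.
    gauss-pascal : ∀ i k → gauss (suc i) (suc k) ≈ gauss (suc i) k + p ^ suc k * gauss i (suc k)
    gauss-pascal zero zero = refl
    gauss-pascal zero (suc k) = begin
      1# + p ^ 1 * gauss 1 (suc k)                ≈⟨ +-congˡ (*-congˡ (gauss-pascal zero k)) ⟩
      1# + p ^ 1 * (gauss 1 k + p ^ suc k * 1#)   ≈⟨ regroup p (gauss 1 k) (p ^ suc k) ⟩
      gauss 1 (suc k) + p ^ suc (suc k) * 1#      ∎
      where
      regroup : ∀ p g x → 1# + p * 1# * (g + x * 1#) ≈ 1# + p * 1# * g + p * x * 1#
      regroup = solve 3 (λ p g x → con 1 :+ p :* con 1 :* (g :+ x :* con 1) := con 1 :+ p :* con 1 :* g :+ p :* x :* con 1) refl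
    gauss-pascal (suc i) zero = begin
      gauss (suc i) 1 + p ^ suc (suc i) * 1#                  ≈⟨ +-congʳ (gauss-pascal i zero) ⟩
      gauss (suc i) 0 + p ^ 1 * gauss i 1 + p * p ^ suc i * 1#   ≈⟨ +-congʳ (+-congʳ (gauss-0 (suc i))) ⟩
      1# + p ^ 1 * gauss i 1 + p * p ^ suc i * 1#             ≈⟨ regroup p (gauss i 1) (p ^ suc i) ⟩
      1# + p ^ 1 * (gauss i 1 + p ^ suc i * 1#)               ∎
      where
      regroup : ∀ p g x → 1# + p * 1# * g + p * x * 1# ≈ 1# + p * 1# * (g + x * 1#)
      regroup = solve 3 (λ p g x → con 1 :+ p :* con 1 :* g :+ p :* x :* con 1 := con 1 :+ p :* con 1 :* (g :+ x :* con 1)) refl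
    gauss-pascal (suc i) (suc k) = begin
      gauss (suc i) (suc (suc k)) + p ^ suc (suc i) * gauss (suc (suc i)) (suc k)
        ≈⟨ +-cong (gauss-pascal i (suc k)) (*-congˡ (gauss-pascal (suc i) k)) ⟩
      gauss (suc i) (suc k) + p ^ suc (suc k) * gauss i (suc (suc k))
        + p ^ suc (suc i) * (gauss (suc (suc i)) k + p ^ suc k * gauss (suc i) (suc k))
        ≈⟨ regroup (gauss (suc i) (suc k)) (gauss i (suc (suc k))) (gauss (suc (suc i)) k) p (p ^ suc i) (p ^ suc k) ⟩
      (gauss (suc i) (suc k) + p ^ suc (suc i) * gauss (suc (suc i)) k)
        + p ^ suc (suc k) * (gauss i (suc (suc k)) + p ^ suc i * gauss (suc i) (suc k)) ∎
      where
      regroup : ∀ g h j p x y → g + p * y * h + p * x * (j + y * g) ≈ g + p * x * j + p * y * (h + x * g)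
      regroup = solve 6 (λ g h j p x y → g :+ p :* y :* h :+ p :* x :* (j :+ y :* g) := g :+ p :* x :* j :+ p :* y :* (h :+ x :* g)) refl

    -- Since 1 − p^{i+k+2} = (1 − p^{i+1}) + p^{i+1} (1 − p^{k+1}).
    gauss-Q : ∀ i k → gauss i k * (Q i (- p) p * Q k (- p) p) ≈ Q (i ℕ.+ k) (- p) p
    gauss-Q zero    k       = trans (*-identityˡ _) (*-identityˡ _)
    gauss-Q (suc i) zero    = trans (*-identityˡ _) (trans (*-identityʳ _)
      (reflexive (≡.cong (λ m → Q m (- p) p) (≡.sym (ℕₚ.+-identityʳ (suc i))))))
    gauss-Q (suc i) (suc k) = begin
      (gauss i (suc k) + p ^ suc i * gauss (suc i) k) * (qi * u * (qk * v))
        ≈⟨ regroup (gauss i (suc k)) (gauss (suc i) k) (p ^ suc i) qi u qk v ⟩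
      gauss i (suc k) * (qi * (qk * v)) * u + gauss (suc i) k * (qi * u * qk) * (p ^ suc i * v)
        ≈⟨ +-cong (*-congʳ (gauss-Q i (suc k))) (*-congʳ (gauss-Q (suc i) k)) ⟩
      Q (i ℕ.+ suc k) (- p) p * u + Q (suc i ℕ.+ k) (- p) p * (p ^ suc i * v)
        ≈⟨ +-congʳ (*-congʳ (reflexive (≡.cong (λ m → Q m (- p) p) (ℕₚ.+-suc i k)))) ⟩
      Q (suc i ℕ.+ k) (- p) p * u + Q (suc i ℕ.+ k) (- p) p * (p ^ suc i * v)
        ≈⟨ distribˡ _ _ _ ⟨
      Q (suc i ℕ.+ k) (- p) p * (u + p ^ suc i * v)
        ≈⟨ *-congˡ last ⟩
      Q (suc (suc i ℕ.+ k)) (- p) p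
        ≡⟨ ≡.cong (λ m → Q m (- p) p) (ℕₚ.+-suc (suc i) k) ⟨
      Q (suc i ℕ.+ suc k) (- p) p ∎
      where
      qi qk u v : Carrier
      qi = Q i (- p) p
      qk = Q k (- p) p
      u  = 1# + - p * p ^ i
      v  = 1# + - p * p ^ k
      regroup : ∀ g h x a u b v → (g + x * h) * (a * u * (b * v)) ≈ g * (a * (b * v)) * u + h * (a * u * b) * (x * v)
      regroup = solve 7 (λ g h x a u b v → (g :+ x :* h) :* (a :* u :* (b :* v)) := g :* (a :* (b :* v)) :* u :+ h :* (a :* u :* b) :* (x :* v)) refl
      last : u + p ^ suc i * v ≈ 1# + - p * p ^ suc (i ℕ.+ k)
      last = begin
        u + p ^ suc i * v                                     ≈⟨ expand p (- p) (p ^ i) (p ^ k) ⟩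
        1# + (- p + p) * p ^ i + - p * (p * (p ^ i * p ^ k))  ≈⟨ +-congʳ (+-congˡ (trans (*-congʳ (-‿inverseˡ p)) (zeroˡ _))) ⟩
        1# + 0# + - p * (p * (p ^ i * p ^ k))                 ≈⟨ +-cong (+-identityʳ 1#) (*-congˡ (*-congˡ (sym (^-homo-* p i k)))) ⟩
        1# + - p * p ^ suc (i ℕ.+ k)                          ∎
        where
        expand : ∀ p n x y → 1# + n * x + p * x * (1# + n * y) ≈ 1# + (n + p) * x + n * (p * (x * y))
        expand = solve 4 (λ p n x y → con 1 :+ n :* x :+ p :* x :* (con 1 :+ n :* y) := con 1 :+ (n :+ p) :* x :+ n :* (p :* (x :* y))) refl

    gaussSum : ℕ → (ℕ → Carrier) → Carrier
    gaussSum n X = antidiagonal n (λ i k → X i * gauss i k)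

    -- Pascal's rule inside the sum trades one unit of the order for a change of weights. In
    -- `finite-jacobi` this change of weights is multiplication by one further factor of the
    -- product.
    gaussSum-stepˡ : ∀ n X → gaussSum (suc n) X ≈
                     antidiagonal n (λ i k → (p ^ i * X i + X (suc i)) * gauss i k)
    gaussSum-stepˡ zero X = regroup (X 0) (X 1)
      where
      regroup : ∀ x y → x * 1# + y * 1# ≈ (1# * x + y) * 1#
      regroup = solve 2 (λ x y → x :* con 1 :+ y :* con 1 := (con 1 :* x :+ y) :* con 1) refl
    gaussSum-stepˡ (suc n) X = begin
      X 0 * 1# + antidiagonal (suc n) (λ i k → X (suc i) * gauss (suc i) k)
        ≈⟨ +-congˡ (antidiagonal-last n (λ i k → X (suc i) * gauss (suc i) k)) ⟩
      X 0 * 1# + (antidiagonal n (λ i k → X (suc i) * gauss (suc i) (suc k)) + X (suc (suc n)) * 1#)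
        ≈⟨ +-congˡ (+-congʳ (trans (antidiagonal-cong n (λ i k _ → expand (X (suc i)) (gauss i (suc k)) (p ^ suc i) (gauss (suc i) k)))
                                   (antidiagonal-+ n _ _))) ⟩
      -- The first end term completes `s`, and the last completes `t`, to a sum over the whole
      -- antidiagonal `suc n`.
      X 0 * 1# + (s + t + X (suc (suc n)) * 1#)
        ≈⟨ regroup (X 0) s t (X (suc (suc n)) * 1#) ⟩
      (1# * X 0 * 1# + s) + (t + X (suc (suc n)) * 1#)
        ≈⟨ +-congˡ (+-congˡ (*-congˡ (sym (gauss-0 (suc n))))) ⟩
      (1# * X 0 * 1# + s) + (t + X (suc (suc n)) * gauss (suc n) 0)
        ≈⟨ +-congˡ (antidiagonal-last n (λ i k → X (suc i) * gauss i k)) ⟨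
      antidiagonal (suc n) (λ i k → p ^ i * X i * gauss i k) + antidiagonal (suc n) (λ i k → X (suc i) * gauss i k)
        ≈⟨ antidiagonal-distribʳ (suc n) (λ i _ → p ^ i * X i) (λ i _ → X (suc i)) gauss ⟨
      antidiagonal (suc n) (λ i k → (p ^ i * X i + X (suc i)) * gauss i k) ∎
      where
      s t : Carrier
      s = antidiagonal n (λ i k → p ^ suc i * X (suc i) * gauss (suc i) k)
      t = antidiagonal n (λ i k → X (suc i) * gauss i (suc k))
      expand : ∀ x g y h → x * (g + y * h) ≈ y * x * h + x * g
      expand = solve 4 (λ x g y h → x :* (g :+ y :* h) := y :* x :* h :+ x :* g) refl
      regroup : ∀ x s t y → x * 1# + (s + t + y) ≈ (1# * x * 1# + s) + (t + y)
      regroup = solve 4 (λ x s t y → x :* con 1 :+ (s :+ t :+ y) := (con 1 :* x :* con 1 :+ s) :+ (t :+ y)) refl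

    -- The same computation with the mirrored rule `gauss-pascal`, so that the power of `p` falls on
    -- the shifted weight.
    gaussSum-stepʳ : ∀ n X → gaussSum (suc n) X ≈
                     antidiagonal n (λ i k → (X i + p ^ k * X (suc i)) * gauss i k)
    gaussSum-stepʳ zero X = regroup (X 0) (X 1)
      where
      regroup : ∀ x y → x * 1# + y * 1# ≈ (x + 1# * y) * 1#
      regroup = solve 2 (λ x y → x :* con 1 :+ y :* con 1 := (x :+ con 1 :* y) :* con 1) refl
    gaussSum-stepʳ (suc n) X = begin
      X 0 * 1# + antidiagonal (suc n) (λ i k → X (suc i) * gauss (suc i) k)
        ≈⟨ +-congˡ (antidiagonal-last n (λ i k → X (suc i) * gauss (suc i) k)) ⟩
      X 0 * 1# + (antidiagonal n (λ i k → X (suc i) * gauss (suc i) (suc k)) + X (suc (suc n)) * 1#)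
        ≈⟨ +-congˡ (+-congʳ (trans (antidiagonal-cong n (λ i k _ → trans (*-congˡ (gauss-pascal i k))
                                     (expand (X (suc i)) (gauss (suc i) k) (p ^ suc k) (gauss i (suc k)))))
                                   (antidiagonal-+ n _ _))) ⟩
      X 0 * 1# + (s + t + X (suc (suc n)) * 1#)
        ≈⟨ regroup (X 0) s t (X (suc (suc n))) ⟩
      (X 0 * 1# + s) + (t + 1# * X (suc (suc n)) * 1#)
        ≈⟨ +-congˡ (+-congˡ (*-congˡ (sym (gauss-0 (suc n))))) ⟩
      (X 0 * 1# + s) + (t + 1# * X (suc (suc n)) * gauss (suc n) 0)
        ≈⟨ +-congˡ (antidiagonal-last n (λ i k → p ^ k * X (suc i) * gauss i k)) ⟨
      antidiagonal (suc n) (λ i k → X i * gauss i k) + antidiagonal (suc n) (λ i k → p ^ k * X (suc i) * gauss i k)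
        ≈⟨ antidiagonal-distribʳ (suc n) (λ i _ → X i) (λ i k → p ^ k * X (suc i)) gauss ⟨
      antidiagonal (suc n) (λ i k → (X i + p ^ k * X (suc i)) * gauss i k) ∎
      where
      s t : Carrier
      s = antidiagonal n (λ i k → X (suc i) * gauss (suc i) k)
      t = antidiagonal n (λ i k → p ^ suc k * X (suc i) * gauss i (suc k))
      expand : ∀ x g y h → x * (g + y * h) ≈ x * g + y * x * h
      expand = solve 4 (λ x g y h → x :* (g :+ y :* h) := x :* g :+ y :* x :* h) refl
      regroup : ∀ x s t y → x * 1# + (s + t + y * 1#) ≈ (x * 1# + s) + (t + 1# * y * 1#)
      regroup = solve 4 (λ x s t y → x :* con 1 :+ (s :+ t :+ y :* con 1) := (x :* con 1 :+ s) :+ (t :+ con 1 :* y :* con 1)) refl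

    module _ (a b : Carrier) (ab≈p : a * b ≈ p) where

      posTerm negTerm : ℕ → Carrier
      posTerm i = thetaTerm a p i
      negTerm i = thetaTerm b p (suc i)

      -- For j = i − n, the term a^{j(j+1)/2} b^{j(j−1)/2} of the theta series.
      term : ℕ → ℕ → Carrier
      term zero    i       = posTerm i
      term (suc n) zero    = negTerm n
      term (suc n) (suc i) = term n i

      -- The terms of index `j = i − n` and `j + 1` have ratio `a p^j`, and `j + k = m` on the
      -- antidiagonal. The factor `p ^ k` on the left keeps negative powers of `p` away.
      term-a : ∀ m n i k → i ℕ.+ k ≡ m ℕ.+ n → p ^ k * term n (suc i) ≈ term n i * (a * p ^ m)
      term-a m zero i k eq = begin
        p ^ k * (a * a ^ i * p ^ (τ i ℕ.+ i))   ≈⟨ *-congˡ (*-congˡ (^-homo-* p (τ i) i)) ⟩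
        p ^ k * (a * a ^ i * (p ^ τ i * p ^ i)) ≈⟨ regroup (p ^ k) a (a ^ i) (p ^ τ i) (p ^ i) ⟩
        posTerm i * (a * (p ^ i * p ^ k))       ≈⟨ *-congˡ (*-congˡ (^-homo-* p i k)) ⟨
        posTerm i * (a * p ^ (i ℕ.+ k))         ≡⟨ ≡.cong (λ e → posTerm i * (a * p ^ e)) (≡.trans eq (ℕₚ.+-identityʳ m)) ⟩
        posTerm i * (a * p ^ m)                 ∎
        where
        regroup : ∀ x a y z w → x * (a * y * (z * w)) ≈ y * z * (a * (w * x))
        regroup = solve 5 (λ x a y z w → x :* (a :* y :* (z :* w)) := y :* z :* (a :* (w :* x))) refl
      term-a m (suc n) zero k eq = begin
        p ^ k * term n 0                        ≡⟨ ≡.cong₂ (λ e x → p ^ e * x) (≡.trans eq (ℕₚ.+-suc m n)) ≡.refl ⟩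
        p * p ^ (m ℕ.+ n) * term n 0            ≈⟨ *-cong (*-cong (sym ab≈p) (^-homo-* p m n)) (term-0 n) ⟩
        a * b * (p ^ m * p ^ n) * (b ^ n * p ^ τ n)   ≈⟨ regroup a b (p ^ m) (p ^ n) (b ^ n) (p ^ τ n) ⟩
        b * b ^ n * (p ^ τ n * p ^ n) * (a * p ^ m) ≈⟨ *-congʳ (*-congˡ (^-homo-* p (τ n) n)) ⟨
        negTerm n * (a * p ^ m)                 ∎
        where
        term-0 : ∀ n → term n 0 ≈ b ^ n * p ^ τ n
        term-0 zero    = refl
        term-0 (suc n) = refl
        regroup : ∀ a b x y z w → a * b * (x * y) * (z * w) ≈ b * z * (w * y) * (a * x)
        regroup = solve 6 (λ a b x y z w → a :* b :* (x :* y) :* (z :* w) := b :* z :* (w :* y) :* (a :* x)) refl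
      term-a m (suc n) (suc i) k eq = term-a m n i k (ℕₚ.suc-injective (≡.trans eq (ℕₚ.+-suc m n)))

      -- Raising `n` lowers the index `j = i − n` by one, which multiplies the term by `b p^{−j}`;
      -- the factor `p ^ i` turns this into `b p^n`.
      term-b : ∀ n i → p ^ i * term (suc n) i ≈ term n i * (b * p ^ n)
      term-b zero zero = regroup b
        where
        regroup : ∀ b → 1# * (b * 1# * 1#) ≈ 1# * 1# * (b * 1#)
        regroup = solve 1 (λ b → con 1 :* (b :* con 1 :* con 1) := con 1 :* con 1 :* (b :* con 1)) refl
      term-b (suc n) zero = begin
        1# * (b * (b * b ^ n) * p ^ (τ (suc n) ℕ.+ suc n))         ≈⟨ *-congˡ (*-congˡ (^-homo-* p (τ (suc n)) (suc n))) ⟩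
        1# * (b * (b * b ^ n) * (p ^ τ (suc n) * p ^ suc n))       ≈⟨ regroup b (b ^ n) (p ^ τ (suc n)) (p ^ suc n) ⟩
        b * b ^ n * p ^ τ (suc n) * (b * p ^ suc n)                ∎
        where
        regroup : ∀ b x y z → 1# * (b * (b * x) * (y * z)) ≈ b * x * y * (b * z)
        regroup = solve 4 (λ b x y z → con 1 :* (b :* (b :* x) :* (y :* z)) := b :* x :* y :* (b :* z)) refl
      term-b zero (suc i) = begin
        p * p ^ i * (a ^ i * p ^ τ i)                    ≈⟨ *-congʳ (*-congʳ ab≈p) ⟨
        a * b * p ^ i * (a ^ i * p ^ τ i)                ≈⟨ regroup a b (p ^ i) (a ^ i) (p ^ τ i) ⟩
        a * a ^ i * (p ^ τ i * p ^ i) * (b * 1#)         ≈⟨ *-congʳ (*-congˡ (^-homo-* p (τ i) i)) ⟨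
        a * a ^ i * p ^ (τ i ℕ.+ i) * (b * 1#)           ∎
        where
        regroup : ∀ a b x y z → a * b * x * (y * z) ≈ a * y * (z * x) * (b * 1#)
        regroup = solve 5 (λ a b x y z → a :* b :* x :* (y :* z) := a :* y :* (z :* x) :* (b :* con 1)) refl
      term-b (suc n) (suc i) = begin
        p * p ^ i * term (suc n) i      ≈⟨ *-assoc _ _ _ ⟩
        p * (p ^ i * term (suc n) i)    ≈⟨ *-congˡ (term-b n i) ⟩
        p * (term n i * (b * p ^ n))    ≈⟨ regroup p (term n i) b (p ^ n) ⟩
        term n i * (b * (p * p ^ n))    ∎
        where
        regroup : ∀ p t b x → p * (t * (b * x)) ≈ t * (b * (p * x))
        regroup = solve 4 (λ p t b x → p :* (t :* (b :* x)) := t :* (b :* (p :* x))) refl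

      -- The q-binomial theorem with shifted index. By `term-a` and `term-b`, each new factor of the
      -- product changes the weights exactly as one step of `gaussSum` does.
      finite-jacobi : ∀ m n → Q m a p * Q n b p ≈ gaussSum (m ℕ.+ n) (term n)
      finite-jacobi zero zero = sym (*-identityʳ _)
      finite-jacobi (suc m) n = begin
        Q m a p * (1# + a * p ^ m) * Q n b p                  ≈⟨ xy∙z≈xz∙y _ _ _ ⟩
        Q m a p * Q n b p * (1# + a * p ^ m)                  ≈⟨ *-congʳ (finite-jacobi m n) ⟩
        gaussSum (m ℕ.+ n) (term n) * (1# + a * p ^ m)        ≈⟨ antidiagonal-* (m ℕ.+ n) _ _ ⟨
        antidiagonal (m ℕ.+ n) (λ i k → term n i * gauss i k * (1# + a * p ^ m))
          ≈⟨ antidiagonal-cong (m ℕ.+ n) (λ i k eq → trans (regroup _ _ _) (*-congʳ (+-congˡ (sym (term-a m n i k eq))))) ⟩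
        antidiagonal (m ℕ.+ n) (λ i k → (term n i + p ^ k * term n (suc i)) * gauss i k)
          ≈⟨ gaussSum-stepʳ (m ℕ.+ n) (term n) ⟨
        gaussSum (suc m ℕ.+ n) (term n)                       ∎
        where
        regroup : ∀ t g x → t * g * (1# + x) ≈ (t + t * x) * g
        regroup = solve 3 (λ t g x → t :* g :* (con 1 :+ x) := (t :+ t :* x) :* g) refl
      finite-jacobi zero (suc n) = begin
        1# * (Q n b p * (1# + b * p ^ n))                     ≈⟨ *-assoc _ _ _ ⟨
        1# * Q n b p * (1# + b * p ^ n)                       ≈⟨ *-congʳ (finite-jacobi zero n) ⟩
        gaussSum n (term n) * (1# + b * p ^ n)                ≈⟨ antidiagonal-* n _ _ ⟨
        antidiagonal n (λ i k → term n i * gauss i k * (1# + b * p ^ n))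
          ≈⟨ antidiagonal-cong n (λ i k _ → trans (regroup _ _ _) (*-congʳ (+-congʳ (sym (term-b n i))))) ⟩
        antidiagonal n (λ i k → (p ^ i * term (suc n) i + term n i) * gauss i k)
          ≈⟨ gaussSum-stepˡ n (term (suc n)) ⟨
        gaussSum (suc n) (term (suc n))                       ∎
        where
        regroup : ∀ t g x → t * g * (1# + x) ≈ (t * x + t) * g
        regroup = solve 3 (λ t g x → t :* g :* (con 1 :+ x) := (t :* x :+ t) :* g) refl

      antidiagonal-term : ∀ m n → antidiagonal (m ℕ.+ n) (λ i _ → term n i) ≈ ∑ (suc m) posTerm + ∑ n negTerm
      antidiagonal-term zero    zero    = trans (sym (+-identityˡ _)) (sym (+-identityʳ _))
      antidiagonal-term (suc m) zero    = begin
        antidiagonal (suc m ℕ.+ 0) (λ i _ → posTerm i)               ≡⟨ ≡.cong (λ e → antidiagonal e (λ i _ → posTerm i)) (ℕₚ.+-identityʳ (suc m)) ⟩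
        antidiagonal (suc m) (λ i _ → posTerm i)                     ≈⟨ antidiagonal-last m (λ i _ → posTerm i) ⟩
        antidiagonal m (λ i _ → posTerm i) + posTerm (suc m)         ≡⟨ ≡.cong (λ e → antidiagonal e (λ i _ → posTerm i) + posTerm (suc m)) (ℕₚ.+-identityʳ m) ⟨
        antidiagonal (m ℕ.+ 0) (λ i _ → posTerm i) + posTerm (suc m) ≈⟨ +-congʳ (trans (antidiagonal-term m zero) (+-identityʳ _)) ⟩
        ∑ (suc (suc m)) posTerm                                      ≈⟨ +-identityʳ _ ⟨
        ∑ (suc (suc m)) posTerm + 0#                                 ∎
      antidiagonal-term m (suc n) = begin
        antidiagonal (m ℕ.+ suc n) (λ i _ → term (suc n) i)          ≡⟨ ≡.cong (λ e → antidiagonal e (λ i _ → term (suc n) i)) (ℕₚ.+-suc m n) ⟩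
        negTerm n + antidiagonal (m ℕ.+ n) (λ i _ → term n i)        ≈⟨ +-congˡ (antidiagonal-term m n) ⟩
        negTerm n + (∑ (suc m) posTerm + ∑ n negTerm)                ≈⟨ x∙yz≈y∙zx _ _ _ ⟩
        ∑ (suc m) posTerm + ∑ (suc n) negTerm                        ∎
        where open CommutativeSemigroupProperties +-commutativeSemigroup using (x∙yz≈y∙zx)

-- Nilpotent elements: cancellation and the limit of the triple product

module Nilpotent {c ℓ} (R : CommutativeRing c ℓ) (N : ℕ) where
  open CommutativeRing R hiding (zero)
  open SetoidReasoning setoid
  open Exp commutativeSemiring
  open RingProperties ring using (-‿distribʳ-*)
  open GroupProperties +-group using (x∙y⁻¹≈ε⇒x≈y)
  open FiniteJacobi R

  -- Stands in for "multiple of `q`" in a ring without a notion of order: modulo `q^N` such series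
  -- have vanishing `N`-th power.
  Small : Carrier → Set ℓ
  Small x = x ^ N ≈ 0#

  small-cong : ∀ {x y} → x ≈ y → Small x → Small y
  small-cong x≈y sx = trans (^-congˡ N (sym x≈y)) sx

  small-* : ∀ {x} y → Small x → Small (x * y)
  small-* {x} y sx = trans (^-distrib-* x y N) (trans (*-congʳ sx) (zeroˡ _))

  small-neg : ∀ {x} → Small x → Small (- x)
  small-neg {x} sx = small-cong (trans (sym (-‿distribʳ-* x 1#)) (-‿cong (*-identityʳ x))) (small-* (- 1#) sx)

  small-pow : ∀ {x i} → N ≤ i → Small x → x ^ i ≈ 0#
  small-pow {x} {i} N≤i sx = begin
    x ^ i                     ≡⟨ ≡.cong (x ^_) (ℕₚ.m+[n∸m]≡n N≤i) ⟨
    x ^ (N ℕ.+ (i ℕ.∸ N))     ≈⟨ ^-homo-* x N (i ℕ.∸ N) ⟩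
    x ^ N * x ^ (i ℕ.∸ N)     ≈⟨ *-congʳ sx ⟩
    0# * x ^ (i ℕ.∸ N)        ≈⟨ zeroˡ _ ⟩
    0#                        ∎

  -- Cancellation replaces division throughout, so no inverse of a product has to be constructed.
  Regular : Carrier → Set _
  Regular x = ∀ {y z} → x * y ≈ x * z → y ≈ z

  regular-* : ∀ {x y} → Regular x → Regular y → Regular (x * y)
  regular-* rx ry eq = ry (rx (trans (sym (*-assoc _ _ _)) (trans eq (*-assoc _ _ _))))

  regular-1 : Regular 1#
  regular-1 eq = trans (sym (*-identityˡ _)) (trans eq (*-identityˡ _))

  regular-^ : ∀ {x} n → Regular x → Regular (x ^ n)
  regular-^ zero    rx = regular-1
  regular-^ (suc n) rx = regular-* rx (regular-^ n rx)

  -- If (1 + x) d = 0 then d = (−x)ⁿ d for all n.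
  regular-1+ : ∀ {x} → Small x → Regular (1# + x)
  regular-1+ {x} sx {y} {z} eq = x∙y⁻¹≈ε⇒x≈y y z (begin
    d                 ≈⟨ iterate N ⟩
    (- x) ^ N * d     ≈⟨ *-congʳ (small-neg sx) ⟩
    0# * d            ≈⟨ zeroˡ d ⟩
    0#                ∎)
    where
    d : Carrier
    d = y + - z
    [1+x]d≈0 : (1# + x) * d ≈ 0#
    [1+x]d≈0 = trans (distribˡ _ _ _) (trans (+-cong eq (sym (-‿distribʳ-* _ _))) (-‿inverseʳ _))
    d≈-xd : d ≈ - x * d
    d≈-xd = begin
      d                         ≈⟨ +-identityʳ d ⟨
      d + 0#                    ≈⟨ +-congˡ (trans (*-congʳ (-‿inverseʳ x)) (zeroˡ d)) ⟨
      d + (x + - x) * d         ≈⟨ regroup d x (- x) ⟩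
      (1# + x) * d + - x * d    ≈⟨ trans (+-congʳ [1+x]d≈0) (+-identityˡ _) ⟩
      - x * d                   ∎
      where
      open NaturalCoefficients commutativeSemiring
      regroup : ∀ d x n → d + (x + n) * d ≈ (1# + x) * d + n * d
      regroup = solve 3 (λ d x n → d :+ (x :+ n) :* d := (con 1 :+ x) :* d :+ n :* d) refl
    iterate : ∀ n → d ≈ (- x) ^ n * d
    iterate zero    = sym (*-identityˡ d)
    iterate (suc n) = trans d≈-xd (trans (*-congˡ (iterate n)) (sym (*-assoc _ _ _)))

  regular-∏ : ∀ n {g} → (∀ i → Regular (g i)) → Regular (∏ n g)
  regular-∏ zero    rg = regular-1
  regular-∏ (suc n) rg = regular-* (regular-∏ n rg) (rg n)

  regular-Q : ∀ n {c} p → Small c → Regular (Q n c p)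
  regular-Q n p sc = regular-∏ n (λ i → regular-1+ (small-* (p ^ i) sc))

  -- From index `N` on `p ^ i` vanishes and the factors are 1, so a product of at least `N` factors
  -- is already the infinite product.
  Q-stable : ∀ {n} c {p} → N ≤ n → Small p → Q n c p ≈ Q N c p
  Q-stable c N≤n sp = ∏-stable N≤n (λ i N≤i →
    trans (+-congˡ (trans (*-congˡ (small-pow N≤i sp)) (zeroʳ c))) (+-identityʳ 1#))

  Q-stable₂ : ∀ {m n} c {p} → N ≤ m → N ≤ n → Small p → Q m c p ≈ Q n c p
  Q-stable₂ c N≤m N≤n sp = trans (Q-stable c N≤m sp) (sym (Q-stable c N≤n sp))

  thetaTerm-small : ∀ {a i} p → N ≤ i → Small a → thetaTerm a p i ≈ 0#
  thetaTerm-small p N≤i sa = trans (*-congʳ (small-pow N≤i sa)) (zeroˡ _)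

  module _ {a b p : Carrier} (ab≈p : a * b ≈ p) (sa : Small a) (sb : Small b) where

    private
      L : ℕ
      L = N ℕ.+ N

      sp : Small p
      sp = small-cong ab≈p (small-* b sa)

    -- By `gauss-Q` the coefficient is a quotient of `Q (i + k)` by `Q i` and `Q k`, and all three
    -- have reached their common limit `F`; one `F` cancels.
    gauss-limit : ∀ i k → N ≤ i → N ≤ k → gauss p i k * Q N (- p) p ≈ 1#
    gauss-limit i k N≤i N≤k = regular-Q N p (small-neg sp) (begin
      F * (gauss p i k * F)                         ≈⟨ x∙yz≈y∙xz F (gauss p i k) F ⟩
      gauss p i k * (F * F)                         ≈⟨ *-congˡ (*-cong (Q-stable (- p) N≤i sp) (Q-stable (- p) N≤k sp)) ⟨
      gauss p i k * (Q i (- p) p * Q k (- p) p)     ≈⟨ gauss-Q p i k ⟩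
      Q (i ℕ.+ k) (- p) p                           ≈⟨ Q-stable (- p) (ℕₚ.≤-trans N≤i (ℕₚ.m≤m+n i k)) sp ⟩
      F                                             ≈⟨ *-identityʳ F ⟨
      F * 1#                                        ∎)
      where
      open CommutativeSemigroupProperties *-commutativeSemigroup using (x∙yz≈y∙xz)
      F : Carrier
      F = Q N (- p) p

    term-view : ∀ n i → (∃[ l ] i ≡ n ℕ.+ l × term p a b ab≈p n i ≡ thetaTerm a p l)
                      ⊎ (∃[ l ] n ≡ suc (i ℕ.+ l) × term p a b ab≈p n i ≡ thetaTerm b p (suc l))
    term-view zero    i       = inj₁ (i , ≡.refl , ≡.refl)
    term-view (suc n) zero    = inj₂ (n , ≡.refl , ≡.refl)
    term-view (suc n) (suc i) with term-view n i
    ... | inj₁ (l , eq , eq′) = inj₁ (l , ≡.cong suc eq , eq′)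
    ... | inj₂ (l , eq , eq′) = inj₂ (l , ≡.cong suc eq , eq′)

    zero-absorbs : ∀ {t x y} → t ≈ 0# → t * x * y ≈ t
    zero-absorbs t≈0 = trans (*-congʳ (trans (*-congʳ t≈0) (zeroˡ _))) (trans (zeroˡ _) (sym t≈0))

    -- If the theta index `i − L` is far from 0, the term itself vanishes. If it is within `N` of 0,
    -- then `L = 2 N` forces both `i` and `k` to be at least `N`, and `gauss-limit` applies.
    term-limit : ∀ i k → i ℕ.+ k ≡ L ℕ.+ L →
                 term p a b ab≈p L i * gauss p i k * Q N (- p) p ≈ term p a b ab≈p L i
    term-limit i k eq with term-view L i
    ... | inj₁ (l , i≡L+l , t≡) with ℕₚ.≤-total N l
    ...   | inj₁ N≤l = zero-absorbs (trans (reflexive t≡) (thetaTerm-small p N≤l sa))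
    ...   | inj₂ l≤N = trans (*-assoc _ _ _) (trans (*-congˡ (gauss-limit i k N≤i N≤k)) (*-identityʳ _))
      where
      N≤i : N ≤ i
      N≤i = ≡.subst (N ≤_) (≡.sym i≡L+l) (ℕₚ.≤-trans (ℕₚ.m≤m+n N N) (ℕₚ.m≤m+n L l))
      l+k≡L : l ℕ.+ k ≡ L
      l+k≡L = ℕₚ.+-cancelˡ-≡ L _ _ (≡.trans (≡.sym (ℕₚ.+-assoc L l k)) (≡.trans (≡.cong (ℕ._+ k) (≡.sym i≡L+l)) eq))
      N≤k : N ≤ k
      N≤k = ℕₚ.+-cancelˡ-≤ N N k (≡.subst (ℕ._≤ N ℕ.+ k) l+k≡L (ℕₚ.+-monoˡ-≤ k l≤N))
    term-limit i k eq | inj₂ (l , L≡1+i+l , t≡) with ℕₚ.≤-<-connex N l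
    ...   | inj₁ N≤l = zero-absorbs (trans (reflexive t≡) (thetaTerm-small p (ℕₚ.m≤n⇒m≤1+n N≤l) sb))
    ...   | inj₂ l<N = trans (*-assoc _ _ _) (trans (*-congˡ (gauss-limit i k N≤i N≤k)) (*-identityʳ _))
      where
      N≤i : N ≤ i
      N≤i = ℕₚ.+-cancelʳ-≤ N N i (ℕₚ.≤-trans (ℕₚ.≤-reflexive (≡.trans L≡1+i+l (≡.sym (ℕₚ.+-suc i l)))) (ℕₚ.+-monoʳ-≤ i l<N))
      i≤L : i ≤ L
      i≤L = ≡.subst (i ≤_) (≡.sym L≡1+i+l) (ℕₚ.m≤n⇒m≤1+n (ℕₚ.m≤m+n i l))
      N≤k : N ≤ k
      N≤k = ℕₚ.≤-trans (ℕₚ.m≤m+n N N) (ℕₚ.+-cancelˡ-≤ L L k (≡.subst (ℕ._≤ L ℕ.+ k) eq (ℕₚ.+-monoˡ-≤ k i≤L)))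

    -- The finite identity with `L` factors on either side, multiplied by the limit of `Q (- p) p`,
    -- which turns every Gaussian binomial that matters into 1. The sum pairs the index `i` with
    -- `− 1 − i`.
    jacobi : ∀ M → N ≤ M →
             Q M a p * Q M b p * Q M (- p) p ≈ ∑ M (λ i → thetaTerm a p i + thetaTerm b p (suc i))
    jacobi M N≤M = begin
      Q M a p * Q M b p * Q M (- p) p
        ≈⟨ *-cong (*-cong (Q-stable₂ a N≤M N≤L sp) (Q-stable₂ b N≤M N≤L sp)) (Q-stable (- p) N≤M sp) ⟩
      Q L a p * Q L b p * Q N (- p) p
        ≈⟨ *-congʳ (finite-jacobi p a b ab≈p L L) ⟩
      gaussSum p (L ℕ.+ L) (term p a b ab≈p L) * Q N (- p) p
        ≈⟨ antidiagonal-* (L ℕ.+ L) _ _ ⟨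
      antidiagonal (L ℕ.+ L) (λ i k → term p a b ab≈p L i * gauss p i k * Q N (- p) p)
        ≈⟨ antidiagonal-cong (L ℕ.+ L) term-limit ⟩
      antidiagonal (L ℕ.+ L) (λ i _ → term p a b ab≈p L i)
        ≈⟨ antidiagonal-term p a b ab≈p L L ⟩
      ∑ (suc L) (thetaTerm a p) + ∑ L (λ i → thetaTerm b p (suc i))
        ≈⟨ +-cong (stable (ℕₚ.m≤n⇒m≤1+n N≤L) N≤M (λ i N≤i → thetaTerm-small p N≤i sa))
                  (stable N≤L N≤M (λ i N≤i → thetaTerm-small p (ℕₚ.m≤n⇒m≤1+n N≤i) sb)) ⟩
      ∑ M (thetaTerm a p) + ∑ M (λ i → thetaTerm b p (suc i))
        ≈⟨ ∑-+ M _ _ ⟨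
      ∑ M (λ i → thetaTerm a p i + thetaTerm b p (suc i)) ∎
      where
      N≤L : N ≤ L
      N≤L = ℕₚ.m≤m+n N N
      stable : ∀ {m n g} → N ≤ m → N ≤ n → (∀ i → N ≤ i → g i ≈ 0#) → ∑ m g ≈ ∑ n g
      stable N≤m N≤n g≈0 = trans (∑-stable N≤m g≈0) (sym (∑-stable N≤n g≈0))

-- Products and dissections of theta series

m≤τ[1+m] : ∀ m → m ≤ τ (suc m)
m≤τ[1+m] m = ℕₚ.m≤n+m m (τ m)

m≤m*m : ∀ m → m ≤ m ℕ.* m
m≤m*m zero    = z≤n
m≤m*m (suc m) = ℕₚ.m≤m+n (suc m) (m ℕ.* suc m)

m+2τm≡m*m : ∀ m → m ℕ.+ 2 ℕ.* τ m ≡ m ℕ.* m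
m+2τm≡m*m zero    = ≡.refl
m+2τm≡m*m (suc m) = ≡.trans (lem₁ m (τ m)) (≡.trans (≡.cong (ℕ._+ suc (m ℕ.+ m)) (m+2τm≡m*m m)) (lem₂ m))
  where
  open +-*-Solver
  lem₁ : ∀ m t → suc m ℕ.+ 2 ℕ.* (t ℕ.+ m) ≡ m ℕ.+ 2 ℕ.* t ℕ.+ suc (m ℕ.+ m)
  lem₁ = solve 2 (λ m t → con 1 :+ m :+ con 2 :* (t :+ m) := m :+ con 2 :* t :+ (con 1 :+ (m :+ m))) ≡.refl
  lem₂ : ∀ m → m ℕ.* m ℕ.+ suc (m ℕ.+ m) ≡ suc m ℕ.* suc m
  lem₂ = solve 1 (λ m → m :* m :+ (con 1 :+ (m :+ m)) := (con 1 :+ m) :* (con 1 :+ m)) ≡.refl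

-- The pentagonal numbers k (3k + 1) / 2 for k = i and k = −1 − i.
α⁺ α⁻ : ℕ → ℕ
α⁺ i = 2 ℕ.* i ℕ.+ 3 ℕ.* τ i
α⁻ i = suc i ℕ.+ 3 ℕ.* τ (suc i)

-- (k² − 1) / 3 for k = 3i + 1 and k = 3i + 2.
γ₁ γ₂ : ℕ → ℕ
γ₁ i = 3 ℕ.* (i ℕ.* i) ℕ.+ 2 ℕ.* i
γ₂ i = 3 ℕ.* (i ℕ.* i) ℕ.+ 4 ℕ.* i ℕ.+ 1

module Theta {c ℓ} (R : CommutativeRing c ℓ) where
  open CommutativeRing R hiding (zero)
  open SetoidReasoning setoid
  open Exp commutativeSemiring
  open RingProperties ring using (-‿distribˡ-*; -‿distribʳ-*)
  open GroupProperties +-group using (⁻¹-involutive)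
  open FiniteJacobi R

  private module S = NaturalCoefficients commutativeSemiring

  -- Ramanujan's ψ(x), φ(x) and A(x) = f(x, x²), cut off after finitely many terms.
  ψ φ A : ℕ → Carrier → Carrier
  ψ n x = ∑ n (λ i → x ^ τ (suc i))
  φ n x = ∑ n (λ i → x ^ (i ℕ.* i) + x ^ (suc i ℕ.* suc i))
  A n x = ∑ n (λ i → x ^ α⁺ i + x ^ α⁻ i)

  -- Truncations of (x; x), (-x; x) and (-x; x²). Thus `F (x ^ k)` is the product usually written
  -- f_k, and `O (- x)` is (x; x²).
  F H O : ℕ → Carrier → Carrier
  F n x = Q n (- x) x
  H n x = Q n x x
  O n x = Q n x (x ^ 2)

  -x*-y≈x*y : ∀ x y → - x * - y ≈ x * y
  -x*-y≈x*y x y = trans (sym (-‿distribˡ-* x (- y)))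
    (trans (-‿cong (sym (-‿distribʳ-* x y))) (⁻¹-involutive (x * y)))

  neg-square : ∀ x → (- x) ^ 2 ≈ x ^ 2
  neg-square x = trans (*-congˡ (*-identityʳ (- x))) (trans (-x*-y≈x*y x x) (*-congˡ (sym (*-identityʳ x))))

  neg-cube : ∀ x → (- x) ^ 3 ≈ - (x ^ 3)
  neg-cube x = trans (*-congˡ (neg-square x)) (sym (-‿distribˡ-* x (x ^ 2)))

  neg-fourth : ∀ x → (- x) ^ 4 ≈ x ^ 4
  neg-fourth x = trans (*-congˡ (neg-cube x)) (-x*-y≈x*y x (x ^ 3))

  ^-comm : ∀ x m n → (x ^ m) ^ n ≈ (x ^ n) ^ m
  ^-comm x m n = trans (^-assocʳ x m n) (trans (^-congʳ x (ℕₚ.*-comm m n)) (sym (^-assocʳ x n m)))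

  Q-cong : ∀ n {c d p r} → c ≈ d → p ≈ r → Q n c p ≈ Q n d r
  Q-cong n c≈d p≈r = ∏-cong n (λ i → +-congˡ (*-cong c≈d (^-congˡ i p≈r)))

  F-cong : ∀ n {x y} → x ≈ y → F n x ≈ F n y
  F-cong n x≈y = Q-cong n (-‿cong x≈y) x≈y

  ^-factor : ∀ x d k {m} → m ≡ d ℕ.* k → x ^ m ≈ (x ^ d) ^ k
  ^-factor x d k eq = trans (^-congʳ x eq) (sym (^-assocʳ x d k))

  ^-factor-suc : ∀ x d k {m} → m ≡ suc (d ℕ.* k) → x ^ m ≈ x * (x ^ d) ^ k
  ^-factor-suc x d k eq = trans (^-congʳ x eq) (*-congˡ (sym (^-assocʳ x d k)))

  thetaTerm-^ : ∀ x a b i → thetaTerm (x ^ a) (x ^ b) i ≈ x ^ (a ℕ.* i ℕ.+ b ℕ.* τ i)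
  thetaTerm-^ x a b i = trans (*-cong (^-assocʳ x a i) (^-assocʳ x b (τ i))) (sym (^-homo-* x (a ℕ.* i) (b ℕ.* τ i)))

  thetaTerm-^₁ : ∀ x b i → thetaTerm x (x ^ b) i ≈ x ^ (i ℕ.+ b ℕ.* τ i)
  thetaTerm-^₁ x b i = trans (*-congˡ (^-assocʳ x b (τ i))) (sym (^-homo-* x i (b ℕ.* τ i)))

  ∏-1 : ∀ m → ∏ m (λ _ → 1#) ≈ 1#
  ∏-1 zero    = refl
  ∏-1 (suc m) = trans (*-identityʳ _) (∏-1 m)

  ∏-swap : ∀ m n (g : ℕ → ℕ → Carrier) → ∏ m (λ i → ∏ n (g i)) ≈ ∏ n (λ j → ∏ m (λ i → g i j))
  ∏-swap m zero    g = ∏-1 m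
  ∏-swap m (suc n) g = trans (∏-* m _ _) (*-congʳ (∏-swap m n g))

  Q-blocks : ∀ n k c p → Q (n ℕ.* k) c p ≈ ∏ k (λ r → Q n (c * p ^ r) (p ^ k))
  Q-blocks n k c p = begin
    Q (n ℕ.* k) c p                                                ≈⟨ ∏-blocks n k _ ⟩
    ∏ n (λ i → ∏ k (λ r → 1# + c * p ^ (r ℕ.+ i ℕ.* k)))           ≈⟨ ∏-cong n (λ i → ∏-cong k (λ r → +-congˡ (split i r))) ⟩
    ∏ n (λ i → ∏ k (λ r → 1# + c * p ^ r * (p ^ k) ^ i))           ≈⟨ ∏-swap n k _ ⟩
    ∏ k (λ r → Q n (c * p ^ r) (p ^ k))                            ∎
    where
    split : ∀ i r → c * p ^ (r ℕ.+ i ℕ.* k) ≈ c * p ^ r * (p ^ k) ^ i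
    split i r = begin
      c * p ^ (r ℕ.+ i ℕ.* k)     ≈⟨ *-congˡ (^-homo-* p r (i ℕ.* k)) ⟩
      c * (p ^ r * p ^ (i ℕ.* k)) ≈⟨ *-assoc _ _ _ ⟨
      c * p ^ r * p ^ (i ℕ.* k)   ≈⟨ *-congˡ (trans (^-congʳ p (ℕₚ.*-comm i k)) (sym (^-assocʳ p k i))) ⟩
      c * p ^ r * (p ^ k) ^ i     ∎

  Q-sign : ∀ n c p → Q n c p * Q n (- c) p ≈ Q n (- (c ^ 2)) (p ^ 2)
  Q-sign n c p = trans (sym (∏-* n _ _)) (∏-cong n factor)
    where
    factor : ∀ i → (1# + c * p ^ i) * (1# + - c * p ^ i) ≈ 1# + - (c ^ 2) * (p ^ 2) ^ i
    factor i = begin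
      (1# + c * p ^ i) * (1# + - c * p ^ i)             ≈⟨ expand c (- c) (p ^ i) ⟩
      1# + (c + - c) * p ^ i + c * - c * (p ^ i) ^ 2    ≈⟨ +-cong (trans (+-congˡ (trans (*-congʳ (-‿inverseʳ c)) (zeroˡ _))) (+-identityʳ 1#))
                                                                  (*-cong (trans (sym (-‿distribʳ-* c c)) (-‿cong (*-congˡ (sym (*-identityʳ c))))) (^-comm p i 2)) ⟩
      1# + - (c ^ 2) * (p ^ 2) ^ i                      ∎
      where
      open S
      expand : ∀ c d x → (1# + c * x) * (1# + d * x) ≈ 1# + (c + d) * x + c * d * (x * (x * 1#))
      expand = solve 3 (λ c d x → (con 1 :+ c :* x) :* (con 1 :+ d :* x) :=
                                  con 1 :+ (c :+ d) :* x :+ c :* d :* (x :* (x :* con 1))) refl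

  geometric : ∀ {a b x y} → a ≈ b + x * y * a → a * (1# + - x * y) ≈ b
  geometric {a} {b} {x} {y} eq = begin
    a * (1# + - x * y)               ≈⟨ solve 3 (λ a x y → a :* (con 1 :+ x :* y) := a :+ x :* y :* a) refl a (- x) y ⟩
    a + - x * y * a                  ≈⟨ +-congʳ eq ⟩
    b + x * y * a + - x * y * a      ≈⟨ solve 5 (λ a b x y n → b :+ x :* y :* a :+ n :* y :* a := b :+ (x :+ n) :* (y :* a)) refl a b x y (- x) ⟩
    b + (x + - x) * (y * a)          ≈⟨ +-congˡ (trans (*-congʳ (-‿inverseʳ x)) (zeroˡ _)) ⟩
    b + 0#                           ≈⟨ +-identityʳ b ⟩
    b                                ∎
    where open S

  ∑-*ˡ : ∀ n x g → ∑ n (λ i → x * g i) ≈ x * ∑ n g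
  ∑-*ˡ zero    x g = sym (zeroʳ x)
  ∑-*ˡ (suc n) x g = trans (+-congʳ (∑-*ˡ n x g)) (sym (distribˡ x _ _))

  -- Taking consecutive triangular numbers in pairs gives the one-sided series ψ(x) the two-sided
  -- shape f(x³, x) to which `jacobi` applies.
  ψ-bisection : ∀ n x → ψ (n ℕ.* 2) x ≈ ∑ n (λ i → thetaTerm (x ^ 3) (x ^ 4) i + thetaTerm x (x ^ 4) (suc i))
  ψ-bisection n x = trans (∑-blocks n 2 _) (∑-cong n (λ i → +-cong
    (trans (+-identityˡ _) (trans (^-congʳ x (even i)) (sym (thetaTerm-^ x 3 4 i))))
    (trans (^-congʳ x (odd i)) (sym (thetaTerm-^₁ x 4 (suc i))))))
    where
    open +-*-Solver
    even : ∀ i → τ (suc (i ℕ.* 2)) ≡ 3 ℕ.* i ℕ.+ 4 ℕ.* τ i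
    even zero    = ≡.refl
    even (suc i) = ≡.trans (≡.cong (λ e → e ℕ.+ suc (i ℕ.* 2) ℕ.+ suc (suc (i ℕ.* 2))) (even i))
      (solve 2 (λ i t → con 3 :* i :+ con 4 :* t :+ (con 1 :+ i :* con 2) :+ (con 2 :+ i :* con 2) :=
                        con 3 :* (con 1 :+ i) :+ con 4 :* (t :+ i)) ≡.refl i (τ i))
    odd : ∀ i → τ (suc (suc (i ℕ.* 2))) ≡ suc i ℕ.+ 4 ℕ.* τ (suc i)
    odd i = ≡.trans (≡.cong (λ e → e ℕ.+ suc (i ℕ.* 2)) (even i))
      (solve 2 (λ i t → con 3 :* i :+ con 4 :* t :+ (con 1 :+ i :* con 2) :=
                        con 1 :+ i :+ con 4 :* (t :+ i)) ≡.refl i (τ i))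

  -- For the triangular numbers T_k, the values T_{3i} and T_{3i+2} are three times generalized
  -- pentagonal numbers, while T_{3i+1} = 9 T_i + 1.
  ψ-trisection : ∀ n x → ψ (n ℕ.* 3) x ≈ A n (x ^ 3) + x * ψ n (x ^ 9)
  ψ-trisection n x = begin
    ψ (n ℕ.* 3) x                         ≈⟨ ∑-blocks n 3 _ ⟩
    ∑ n (λ i → 0# + x ^ τ (suc (i ℕ.* 3)) + x ^ τ (suc (suc (i ℕ.* 3))) + x ^ τ (suc (suc (suc (i ℕ.* 3)))))
      ≈⟨ ∑-cong n (λ i → +-cong (+-cong (trans (+-identityˡ _) (^-factor x 3 (α⁺ i) (r₀ i))) (^-factor-suc x 9 (τ (suc i)) (r₁ i))) (^-factor x 3 (α⁻ i) (r₂ i))) ⟩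
    ∑ n (λ i → a i + x * b i + c′ i)      ≈⟨ ∑-cong n (λ i → xy∙z≈xz∙y _ _ _) ⟩
    ∑ n (λ i → a i + c′ i + x * b i)      ≈⟨ ∑-+ n _ _ ⟩
    A n (x ^ 3) + ∑ n (λ i → x * b i)     ≈⟨ +-congˡ (∑-*ˡ n x _) ⟩
    A n (x ^ 3) + x * ψ n (x ^ 9)         ∎
    where
    open CommutativeSemigroupProperties +-commutativeSemigroup using (xy∙z≈xz∙y)
    a b c′ : ℕ → Carrier
    a  i = (x ^ 3) ^ α⁺ i
    b  i = (x ^ 9) ^ τ (suc i)
    c′ i = (x ^ 3) ^ α⁻ i
    open +-*-Solver
    r₀ : ∀ i → τ (suc (i ℕ.* 3)) ≡ 3 ℕ.* α⁺ i
    r₀ zero    = ≡.refl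
    r₀ (suc i) = ≡.trans (≡.cong (λ e → e ℕ.+ suc (i ℕ.* 3) ℕ.+ suc (suc (i ℕ.* 3)) ℕ.+ suc (suc (suc (i ℕ.* 3)))) (r₀ i))
      (solve 2 (λ i t → con 3 :* (con 2 :* i :+ con 3 :* t) :+ (con 1 :+ i :* con 3) :+ (con 2 :+ i :* con 3) :+ (con 3 :+ i :* con 3) :=
                        con 3 :* (con 2 :* (con 1 :+ i) :+ con 3 :* (t :+ i))) ≡.refl i (τ i))
    r₁ : ∀ i → τ (suc (suc (i ℕ.* 3))) ≡ suc (9 ℕ.* τ (suc i))
    r₁ i = ≡.trans (≡.cong (ℕ._+ suc (i ℕ.* 3)) (r₀ i))
      (solve 2 (λ i t → con 3 :* (con 2 :* i :+ con 3 :* t) :+ (con 1 :+ i :* con 3) :=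
                        con 1 :+ con 9 :* (t :+ i)) ≡.refl i (τ i))
    r₂ : ∀ i → τ (suc (suc (suc (i ℕ.* 3)))) ≡ 3 ℕ.* α⁻ i
    r₂ i = ≡.trans (≡.cong (ℕ._+ suc (suc (i ℕ.* 3))) (r₁ i))
      (solve 2 (λ i t → con 1 :+ con 9 :* (t :+ i) :+ (con 2 :+ i :* con 3) :=
                        con 3 :* (con 1 :+ i :+ con 3 :* (t :+ i))) ≡.refl i (τ i))

  -- The terms x^{k²} of φ with k ≢ 0 (mod 3), divided by x and with x³ replaced by x.
  G : ℕ → Carrier → Carrier
  G n x = ∑ n (λ i → (x ^ γ₁ i + x ^ γ₁ i) + (x ^ γ₂ i + x ^ γ₂ i))

  -- A summand of `φ` pairs `k = i` with `k = − 1 − i`, so three consecutive summands contain the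
  -- squares of `3i + 1` and `3i + 2` twice, hence the doubled terms of `G`. The squares of `3i` and
  -- `3i + 3` remain and form one summand of φ(x⁹).
  φ-trisection : ∀ n x → φ (n ℕ.* 3) x ≈ φ n (x ^ 9) + x * G n (x ^ 3)
  φ-trisection n x = begin
    φ (n ℕ.* 3) x                         ≈⟨ ∑-blocks n 3 _ ⟩
    ∑ n (λ i → 0# + (sq (i ℕ.* 3) + sq (1 ℕ.+ i ℕ.* 3)) + (sq (1 ℕ.+ i ℕ.* 3) + sq (2 ℕ.+ i ℕ.* 3))
                  + (sq (2 ℕ.+ i ℕ.* 3) + sq (3 ℕ.+ i ℕ.* 3)))
      ≈⟨ ∑-cong n (λ i → +-cong (+-cong (trans (+-identityˡ _) (+-cong (^-factor x 9 (i ℕ.* i) (s₀ i)) (s₁ i))) (+-cong (s₁ i) (s₂ i)))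
                                (+-cong (s₂ i) (^-factor x 9 (suc i ℕ.* suc i) (s₃ i)))) ⟩
    ∑ n (λ i → a i + x * b i + (x * b i + x * d i) + (x * d i + a′ i))
      ≈⟨ ∑-cong n (λ i → regroup (a i) x (b i) (d i) (a′ i)) ⟩
    ∑ n (λ i → a i + a′ i + x * ((b i + b i) + (d i + d i)))   ≈⟨ ∑-+ n _ _ ⟩
    φ n (x ^ 9) + ∑ n (λ i → x * ((b i + b i) + (d i + d i)))  ≈⟨ +-congˡ (∑-*ˡ n x _) ⟩
    φ n (x ^ 9) + x * G n (x ^ 3)                              ∎
    where
    sq a a′ b d : ℕ → Carrier
    sq m = x ^ (m ℕ.* m)
    a  i = (x ^ 9) ^ (i ℕ.* i)
    a′ i = (x ^ 9) ^ (suc i ℕ.* suc i)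
    b  i = (x ^ 3) ^ γ₁ i
    d  i = (x ^ 3) ^ γ₂ i
    regroup : ∀ a x b d e → a + x * b + (x * b + x * d) + (x * d + e) ≈ a + e + x * ((b + b) + (d + d))
    regroup = solve 5 (λ a x b d e → a :+ x :* b :+ (x :* b :+ x :* d) :+ (x :* d :+ e) :=
                                     a :+ e :+ x :* ((b :+ b) :+ (d :+ d))) refl
      where open S
    open +-*-Solver
    s₀ : ∀ i → (i ℕ.* 3) ℕ.* (i ℕ.* 3) ≡ 9 ℕ.* (i ℕ.* i)
    s₀ = solve 1 (λ i → (i :* con 3) :* (i :* con 3) := con 9 :* (i :* i)) ≡.refl
    s₁ : ∀ i → sq (1 ℕ.+ i ℕ.* 3) ≈ x * b i
    s₁ i = ^-factor-suc x 3 (γ₁ i) (solve 1 (λ i → (con 1 :+ i :* con 3) :* (con 1 :+ i :* con 3) :=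
      con 1 :+ con 3 :* (con 3 :* (i :* i) :+ con 2 :* i)) ≡.refl i)
    s₂ : ∀ i → sq (2 ℕ.+ i ℕ.* 3) ≈ x * d i
    s₂ i = ^-factor-suc x 3 (γ₂ i) (solve 1 (λ i → (con 2 :+ i :* con 3) :* (con 2 :+ i :* con 3) :=
      con 1 :+ con 3 :* (con 3 :* (i :* i) :+ con 4 :* i :+ con 1)) ≡.refl i)
    s₃ : ∀ i → (3 ℕ.+ i ℕ.* 3) ℕ.* (3 ℕ.+ i ℕ.* 3) ≡ 9 ℕ.* (suc i ℕ.* suc i)
    s₃ = solve 1 (λ i → (con 3 :+ i :* con 3) :* (con 3 :+ i :* con 3) := con 9 :* ((con 1 :+ i) :* (con 1 :+ i))) ≡.refl

-- Product formulas for `ψ`, `φ` and `A`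

module ThetaProducts {c ℓ} (R : CommutativeRing c ℓ) (N M : ℕ) (N≤M : N ≤ M) where
  open CommutativeRing R hiding (zero)
  open SetoidReasoning setoid
  open Exp commutativeSemiring
  open RingProperties ring using (-‿distribˡ-*)
  open GroupProperties +-group using (⁻¹-involutive)
  open FiniteJacobi R
  open Nilpotent R N
  open Theta R
  private module S = NaturalCoefficients commutativeSemiring

  ψ-stable : ∀ {n x} → M ≤ n → Small x → ψ n x ≈ ψ M x
  ψ-stable M≤n sx = ∑-stable M≤n (λ i M≤i → small-pow (ℕₚ.≤-trans N≤M (ℕₚ.≤-trans M≤i (m≤τ[1+m] i))) sx)

  φ-stable : ∀ {n x} → M ≤ n → Small x → φ n x ≈ φ M x
  φ-stable M≤n sx = ∑-stable M≤n (λ i M≤i → let N≤i = ℕₚ.≤-trans N≤M M≤i in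
    trans (+-cong (small-pow (ℕₚ.≤-trans N≤i (m≤m*m i)) sx)
                  (small-pow (ℕₚ.≤-trans N≤i (ℕₚ.≤-trans (ℕₚ.n≤1+n i) (m≤m*m (suc i)))) sx))
          (+-identityˡ 0#))

  small-^ : ∀ {x} k → Small x → Small (x ^ suc k)
  small-^ {x} k sx = small-* (x ^ k) sx

  Q-split : ∀ k c {p} → Small p → Q M c p ≈ ∏ (suc k) (λ r → Q M (c * p ^ r) (p ^ suc k))
  Q-split k c sp = trans (Q-stable₂ c N≤M (ℕₚ.≤-trans N≤M (ℕₚ.m≤m*n M (suc k))) sp) (Q-blocks M (suc k) c _)

  Q-split₂ : ∀ c {p} → Small p → Q M c p ≈ Q M c (p ^ 2) * Q M (c * p) (p ^ 2)
  Q-split₂ c {p} sp = trans (Q-split 1 c sp)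
    (*-cong (trans (*-identityˡ _) (Q-cong M (*-identityʳ c) refl)) (Q-cong M (*-congˡ (*-identityʳ p)) refl))

  Q-split₃ : ∀ c {p} → Small p → Q M c p ≈ Q M c (p ^ 3) * Q M (c * p) (p ^ 3) * Q M (c * p ^ 2) (p ^ 3)
  Q-split₃ c {p} sp = trans (Q-split 2 c sp)
    (*-congʳ (*-cong (trans (*-identityˡ _) (Q-cong M (*-identityʳ c) refl)) (Q-cong M (*-congˡ (*-identityʳ p)) refl)))

  H-F : ∀ x → H M x * F M x ≈ F M (x ^ 2)
  H-F x = Q-sign M x x

  H-split : ∀ {x} → Small x → H M x ≈ O M x * H M (x ^ 2)
  H-split {x} sx = trans (Q-split₂ x sx) (*-congˡ (Q-cong M (*-congˡ (sym (*-identityʳ x))) refl))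

  F-split : ∀ {x} → Small x → F M x ≈ O M (- x) * F M (x ^ 2)
  F-split {x} sx = trans (Q-split₂ (- x) sx) (*-cong (Q-cong M refl (sym (neg-square x)))
    (Q-cong M (trans (sym (-‿distribˡ-* x x)) (-‿cong (*-congˡ (sym (*-identityʳ x))))) refl))

  F-neg-split : ∀ {x} → Small x → F M (- x) ≈ O M x * F M (x ^ 2)
  F-neg-split {x} sx = trans (F-split (small-neg sx))
    (*-cong (Q-cong M (⁻¹-involutive x) (^-congˡ 2 (⁻¹-involutive x))) (F-cong M (neg-square x)))

  -- The triple product for f(x³, x) has base x⁴, and its factors starting at `x` and at `x³` are
  -- the two halves of `O x`.
  ψ-product : ∀ {x} → Small x → ψ M x ≈ O M x * F M (x ^ 4)
  ψ-product {x} sx = begin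
    ψ M x                                                             ≈⟨ ψ-stable (ℕₚ.m≤m*n M 2) sx ⟨
    ψ (M ℕ.* 2) x                                                     ≈⟨ ψ-bisection M x ⟩
    ∑ M (λ i → thetaTerm (x ^ 3) (x ^ 4) i + thetaTerm x (x ^ 4) (suc i)) ≈⟨ jacobi (*-comm (x ^ 3) x) (small-^ 2 sx) sx M N≤M ⟨
    Q M (x ^ 3) (x ^ 4) * Q M x (x ^ 4) * F M (x ^ 4)                 ≈⟨ *-congʳ (*-comm _ _) ⟩
    Q M x (x ^ 4) * Q M (x ^ 3) (x ^ 4) * F M (x ^ 4)                 ≈⟨ *-congʳ (*-cong (Q-cong M refl x⁴≈) (Q-cong M refl x⁴≈)) ⟩
    Q M x ((x ^ 2) ^ 2) * Q M (x ^ 3) ((x ^ 2) ^ 2) * F M (x ^ 4)     ≈⟨ *-congʳ (Q-split₂ x (small-^ 1 sx)) ⟨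
    O M x * F M (x ^ 4)                                               ∎
    where
    x⁴≈ : x ^ 4 ≈ (x ^ 2) ^ 2
    x⁴≈ = sym (^-assocʳ x 2 2)

  ψ-product′ : ∀ {x} → Small x → ψ M x ≈ H M x * F M (x ^ 2)
  ψ-product′ {x} sx = begin
    ψ M x                                ≈⟨ ψ-product sx ⟩
    O M x * F M (x ^ 4)                  ≈⟨ *-congˡ (F-cong M (sym (^-assocʳ x 2 2))) ⟩
    O M x * F M ((x ^ 2) ^ 2)            ≈⟨ *-congˡ (H-F (x ^ 2)) ⟨
    O M x * (H M (x ^ 2) * F M (x ^ 2))  ≈⟨ *-assoc _ _ _ ⟨
    O M x * H M (x ^ 2) * F M (x ^ 2)    ≈⟨ *-congʳ (H-split sx) ⟨
    H M x * F M (x ^ 2)                  ∎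

  φ-product : ∀ {x} → Small x → φ M x ≈ O M x ^ 2 * F M (x ^ 2)
  φ-product {x} sx = begin
    φ M x                                                            ≈⟨ ∑-cong M (λ i → +-cong (square i) (square (suc i))) ⟩
    ∑ M (λ i → thetaTerm x (x ^ 2) i + thetaTerm x (x ^ 2) (suc i))  ≈⟨ jacobi (*-congˡ (sym (*-identityʳ x))) sx sx M N≤M ⟨
    O M x * O M x * F M (x ^ 2)                                      ≈⟨ *-congʳ (*-congˡ (*-identityʳ _)) ⟨
    O M x ^ 2 * F M (x ^ 2)                                          ∎
    where
    square : ∀ i → x ^ (i ℕ.* i) ≈ thetaTerm x (x ^ 2) i
    square i = trans (^-congʳ x (≡.sym (m+2τm≡m*m i))) (sym (thetaTerm-^₁ x 2 i))

  -- The triple product for f(x², x) has base x³. Its factors starting at `x` and `x²` are two of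
  -- the three residue classes of `H x`, and the missing class is `H (x ^ 3)`.
  A-product : ∀ {x} → Small x → A M x * H M (x ^ 3) ≈ H M x * F M (x ^ 3)
  A-product {x} sx = begin
    A M x * H M (x ^ 3)
      ≈⟨ *-congʳ (∑-cong M (λ i → +-cong (sym (thetaTerm-^ x 2 3 i)) (sym (thetaTerm-^₁ x 3 (suc i))))) ⟩
    ∑ M (λ i → thetaTerm (x ^ 2) (x ^ 3) i + thetaTerm x (x ^ 3) (suc i)) * H M (x ^ 3)
      ≈⟨ *-congʳ (jacobi (*-comm (x ^ 2) x) (small-^ 1 sx) sx M N≤M) ⟨
    Q M (x ^ 2) (x ^ 3) * Q M x (x ^ 3) * F M (x ^ 3) * H M (x ^ 3)
      ≈⟨ regroup _ _ _ _ ⟩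
    Q M x (x ^ 3) * Q M (x ^ 2) (x ^ 3) * H M (x ^ 3) * F M (x ^ 3)
      ≈⟨ *-congʳ (*-congʳ (*-congˡ (Q-cong M (*-congˡ (*-identityʳ x)) refl))) ⟩
    Q M x (x ^ 3) * Q M (x * x) (x ^ 3) * H M (x ^ 3) * F M (x ^ 3)
      ≈⟨ *-congʳ (Q-split₃ x sx) ⟨
    H M x * F M (x ^ 3) ∎
    where
    open S
    regroup : ∀ a b f h → a * b * f * h ≈ b * a * h * f
    regroup = solve 4 (λ a b f h → a :* b :* f :* h := b :* a :* h :* f) refl

  -- Gauss's formula ψ(x) = f_2² / f_1, cleared of its denominator. Likewise `φ-F` is φ(-x) = f_1² /
  -- f_2.
  ψ-F : ∀ {x} → Small x → ψ M x * F M x ≈ F M (x ^ 2) ^ 2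
  ψ-F {x} sx = begin
    ψ M x * F M x                    ≈⟨ *-congʳ (ψ-product′ sx) ⟩
    H M x * F M (x ^ 2) * F M x      ≈⟨ regroup _ _ _ ⟩
    H M x * F M x * (F M (x ^ 2) * 1#)  ≈⟨ *-congʳ (H-F x) ⟩
    F M (x ^ 2) ^ 2                  ∎
    where
    open S
    regroup : ∀ h f g → h * f * g ≈ h * g * (f * 1#)
    regroup = solve 3 (λ h f g → h :* f :* g := h :* g :* (f :* con 1)) refl

  φ-F : ∀ {x} → Small x → φ M (- x) * F M (x ^ 2) ≈ F M x ^ 2
  φ-F {x} sx = begin
    φ M (- x) * F M (x ^ 2)                                 ≈⟨ *-congʳ (φ-product (small-neg sx)) ⟩
    O M (- x) ^ 2 * F M ((- x) ^ 2) * F M (x ^ 2)           ≈⟨ *-congʳ (*-congˡ (F-cong M (neg-square x))) ⟩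
    O M (- x) ^ 2 * F M (x ^ 2) * F M (x ^ 2)               ≈⟨ regroup (O M (- x)) (F M (x ^ 2)) ⟩
    (O M (- x) * F M (x ^ 2)) ^ 2                           ≈⟨ ^-congˡ 2 (F-split sx) ⟨
    F M x ^ 2                                               ∎
    where
    open S
    regroup : ∀ o f → o * (o * 1#) * f * f ≈ o * f * (o * f * 1#)
    regroup = solve 2 (λ o f → o :* (o :* con 1) :* f :* f := o :* f :* (o :* f :* con 1)) refl

  -- Splitting off the even exponents of both `F (- x)` and `F x` leaves `O x * O (- x)`, which
  -- equals `O (- (x ^ 2))`. Together with `F (x ^ 4)` this reassembles to a third copy of
  -- `F (x ^ 2)`.
  F-neg : ∀ {x} → Small x → F M (- x) * F M x * F M (x ^ 4) ≈ F M (x ^ 2) ^ 3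
  F-neg {x} sx = begin
    F M (- x) * F M x * F M (x ^ 4)
      ≈⟨ *-cong (*-cong (F-neg-split sx) (F-split sx)) (F-cong M (sym (^-assocʳ x 2 2))) ⟩
    O M x * f * (O M (- x) * f) * F M ((x ^ 2) ^ 2)
      ≈⟨ regroup (O M x) f (O M (- x)) _ ⟩
    O M x * O M (- x) * F M ((x ^ 2) ^ 2) * (f * (f * 1#))
      ≈⟨ *-congʳ (*-congʳ (trans (*-congˡ (Q-cong M refl (neg-square x))) (Q-sign M x (x ^ 2)))) ⟩
    Q M (- (x ^ 2)) ((x ^ 2) ^ 2) * F M ((x ^ 2) ^ 2) * (f * (f * 1#))
      ≈⟨ *-congʳ (*-congʳ (Q-cong M refl (neg-square (x ^ 2)))) ⟨
    O M (- (x ^ 2)) * F M ((x ^ 2) ^ 2) * (f * (f * 1#))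
      ≈⟨ *-congʳ (F-split (small-^ 1 sx)) ⟨
    f ^ 3 ∎
    where
    open S
    f : Carrier
    f = F M (x ^ 2)
    regroup : ∀ o f p g → o * f * (p * f) * g ≈ o * p * g * (f * (f * 1#))
    regroup = solve 4 (λ o f p g → o :* f :* (p :* f) :* g := o :* p :* g :* (f :* (f :* con 1))) refl

  regular-F : ∀ {x} → Small x → Regular (F M x)
  regular-F {x} sx = regular-Q M x (small-neg sx)

  -- Products in characteristic three

  module Characteristic3 (3≈0 : 1# + (1# + 1#) ≈ 0#) where

    cube-1+ : ∀ x → (1# + x) ^ 3 ≈ 1# + x ^ 3
    cube-1+ x = begin
      (1# + x) ^ 3                                          ≈⟨ expand x ⟩
      (1# + (1# + 1#)) * (x + x * x) + (1# + x ^ 3)         ≈⟨ +-congʳ (trans (*-congʳ 3≈0) (zeroˡ _)) ⟩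
      0# + (1# + x ^ 3)                                     ≈⟨ +-identityˡ _ ⟩
      1# + x ^ 3                                            ∎
      where
      open S
      expand : ∀ x → (1# + x) * ((1# + x) * ((1# + x) * 1#)) ≈ (1# + (1# + 1#)) * (x + x * x) + (1# + x * (x * (x * 1#)))
      expand = solve 1 (λ x → (con 1 :+ x) :* ((con 1 :+ x) :* ((con 1 :+ x) :* con 1)) :=
        (con 1 :+ (con 1 :+ con 1)) :* (x :+ x :* x) :+ (con 1 :+ x :* (x :* (x :* con 1)))) refl

    -- Cubing is additive here, so each factor is cubed by cubing its second term. This is the
    -- source of every congruence modulo 3 between products.
    Q-cube : ∀ n c p → Q n c p ^ 3 ≈ Q n (c ^ 3) (p ^ 3)
    Q-cube zero    c p = trans (*-identityˡ _) (trans (*-identityˡ _) (*-identityˡ _))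
    Q-cube (suc n) c p = trans (^-distrib-* _ _ 3) (*-cong (Q-cube n c p)
      (trans (cube-1+ _) (+-congˡ (trans (^-distrib-* c _ 3) (*-congˡ (^-comm p n 3))))))

    F-cube : ∀ x → F M x ^ 3 ≈ F M (x ^ 3)
    F-cube x = trans (Q-cube M (- x) x) (Q-cong M (neg-cube x) refl)

    H-cube : ∀ x → H M x ^ 3 ≈ H M (x ^ 3)
    H-cube x = Q-cube M x x

    ψ-cube : ∀ {x} → Small x → ψ M x ^ 3 ≈ ψ M (x ^ 3)
    ψ-cube {x} sx = begin
      ψ M x ^ 3                             ≈⟨ ^-congˡ 3 (ψ-product′ sx) ⟩
      (H M x * F M (x ^ 2)) ^ 3             ≈⟨ ^-distrib-* _ _ 3 ⟩
      H M x ^ 3 * F M (x ^ 2) ^ 3           ≈⟨ *-cong (H-cube x) (trans (F-cube (x ^ 2)) (F-cong M (^-comm x 2 3))) ⟩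
      H M (x ^ 3) * F M ((x ^ 3) ^ 2)       ≈⟨ ψ-product′ (small-^ 2 sx) ⟨
      ψ M (x ^ 3)                           ∎

    φ-cube : ∀ {x} → Small x → φ M x ^ 3 ≈ φ M (x ^ 3)
    φ-cube {x} sx = begin
      φ M x ^ 3                             ≈⟨ ^-congˡ 3 (φ-product sx) ⟩
      (O M x ^ 2 * F M (x ^ 2)) ^ 3         ≈⟨ ^-distrib-* _ _ 3 ⟩
      (O M x ^ 2) ^ 3 * F M (x ^ 2) ^ 3     ≈⟨ *-cong (^-comm (O M x) 2 3) (trans (F-cube (x ^ 2)) (F-cong M (^-comm x 2 3))) ⟩
      (O M x ^ 3) ^ 2 * F M ((x ^ 3) ^ 2)   ≈⟨ *-congʳ (^-congˡ 2 (trans (Q-cube M x (x ^ 2)) (Q-cong M refl (^-comm x 2 3)))) ⟩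
      O M (x ^ 3) ^ 2 * F M ((x ^ 3) ^ 2)   ≈⟨ φ-product (small-^ 2 sx) ⟨
      φ M (x ^ 3)                           ∎

    -- With `F (x ^ 3) = F x ^ 3` and `H (x ^ 3) = H x ^ 3`, `A-product` reads A = f_1³ / H², and H
    -- = f_2 / f_1.
    A-F : ∀ {x} → Small x → A M x * F M (x ^ 2) ^ 2 ≈ F M x ^ 5
    A-F {x} sx = regular-Q M x sx (begin
      h * (A M x * F M (x ^ 2) ^ 2)       ≈⟨ *-congˡ (*-congˡ (^-congˡ 2 (H-F x))) ⟨
      h * (A M x * (h * f) ^ 2)           ≈⟨ regroup h (A M x) f ⟩
      A M x * h ^ 3 * f ^ 2               ≈⟨ *-congʳ (trans (*-congˡ (H-cube x)) (A-product sx)) ⟩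
      h * F M (x ^ 3) * f ^ 2             ≈⟨ *-congʳ (*-congˡ (F-cube x)) ⟨
      h * f ^ 3 * f ^ 2                   ≈⟨ *-assoc _ _ _ ⟩
      h * (f ^ 3 * f ^ 2)                 ≈⟨ *-congˡ (^-homo-* f 3 2) ⟨
      h * f ^ 5                           ∎)
      where
      open S
      h f : Carrier
      h = H M x
      f = F M x
      regroup : ∀ h a f → h * (a * (h * f * (h * f * 1#))) ≈ a * (h * (h * (h * 1#))) * (f * (f * 1#))
      regroup = solve 3 (λ h a f → h :* (a :* (h :* f :* (h :* f :* con 1))) :=
                                    a :* (h :* (h :* (h :* con 1))) :* (f :* (f :* con 1))) refl

    -- With g = F(-x), the left side is (g⁵ / f_2²) (f_2² / g)³ = g² f_2⁴ and the right side is f_4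
    -- (f_2² / f_1)² (f_2² / f_4)³ = f_2¹⁰ / (f_1² f_4²). They agree because g = f_2³ / (f_1 f_4) by
    -- `F-neg`.
    A-ψ : ∀ {x} → Small x →
          A M (- x) * ψ M ((- x) ^ 3) ≈ F M (x ^ 4) * ψ M x ^ 2 * φ M ((- (x ^ 2)) ^ 3)
    A-ψ {x} sx = regular-* (regular-* (regular-^ 2 (regular-F (small-^ 1 sx))) (regular-^ 3 (regular-F (small-neg sx))))
                           (regular-* (regular-^ 2 (regular-F sx)) (regular-^ 3 (regular-F (small-^ 3 sx)))) (begin
      clear * (A M (- x) * ψ M ((- x) ^ 3))
        ≈⟨ *-congˡ (*-congˡ (ψ-cube (small-neg sx))) ⟨
      clear * (A M (- x) * ψ M (- x) ^ 3)
        ≈⟨ solve 6 (λ a p f1 f2 f4 g → f2 :^ 2 :* g :^ 3 :* (f1 :^ 2 :* f4 :^ 3) :* (a :* p :^ 3) :=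
                     a :* f2 :^ 2 :* (p :* g) :^ 3 :* (f1 :^ 2 :* f4 :^ 3)) refl (A M (- x)) (ψ M (- x)) f1 f2 f4 g ⟩
      A M (- x) * f2 ^ 2 * (ψ M (- x) * g) ^ 3 * (f1 ^ 2 * f4 ^ 3)
        ≈⟨ *-congʳ (*-cong (trans (*-congˡ (^-congˡ 2 f2≈)) (A-F (small-neg sx)))
                           (^-congˡ 3 (trans (ψ-F (small-neg sx)) (^-congˡ 2 (sym f2≈))))) ⟩
      g ^ 5 * (f2 ^ 2) ^ 3 * (f1 ^ 2 * f4 ^ 3)
        ≈⟨ solve 4 (λ f1 f2 f4 g → g :^ 5 :* (f2 :^ 2) :^ 3 :* (f1 :^ 2 :* f4 :^ 3) :=
                     (g :* f1 :* f4) :^ 2 :* (g :^ 3 :* f2 :^ 6 :* f4)) refl f1 f2 f4 g ⟩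
      (g * f1 * f4) ^ 2 * (g ^ 3 * f2 ^ 6 * f4)
        ≈⟨ *-congʳ (^-congˡ 2 (F-neg sx)) ⟩
      (f2 ^ 3) ^ 2 * (g ^ 3 * f2 ^ 6 * f4)
        ≈⟨ solve 3 (λ f2 f4 g → (f2 :^ 3) :^ 2 :* (g :^ 3 :* f2 :^ 6 :* f4) :=
                     f4 :* (f2 :^ 2) :^ 2 :* (f2 :^ 2) :^ 3 :* (f2 :^ 2 :* g :^ 3)) refl f2 f4 g ⟩
      f4 * (f2 ^ 2) ^ 2 * (f2 ^ 2) ^ 3 * (f2 ^ 2 * g ^ 3)
        ≈⟨ *-congʳ (*-cong (*-congˡ (^-congˡ 2 (ψ-F sx))) (^-congˡ 3 φ-F′)) ⟨
      f4 * (ψ M x * f1) ^ 2 * (φ M (- (x ^ 2)) * f4) ^ 3 * (f2 ^ 2 * g ^ 3)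
        ≈⟨ solve 6 (λ p h f1 f2 f4 g → f4 :* (p :* f1) :^ 2 :* (h :* f4) :^ 3 :* (f2 :^ 2 :* g :^ 3) :=
                     f2 :^ 2 :* g :^ 3 :* (f1 :^ 2 :* f4 :^ 3) :* (f4 :* p :^ 2 :* h :^ 3)) refl (ψ M x) (φ M (- (x ^ 2))) f1 f2 f4 g ⟩
      clear * (f4 * ψ M x ^ 2 * φ M (- (x ^ 2)) ^ 3)
        ≈⟨ *-congˡ (*-congˡ (φ-cube (small-neg (small-^ 1 sx)))) ⟩
      clear * (f4 * ψ M x ^ 2 * φ M ((- (x ^ 2)) ^ 3)) ∎)
      where
      open S using (solve; _:*_; _:^_; _:=_)
      f1 f2 f4 g clear : Carrier
      f1 = F M x
      f2 = F M (x ^ 2)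
      f4 = F M (x ^ 4)
      g  = F M (- x)
      -- The denominators of `A` and of the cube of `ψ` on the left, then those of the square of `ψ`
      -- and of the cube of `φ` on the right.
      clear = f2 ^ 2 * g ^ 3 * (f1 ^ 2 * f4 ^ 3)
      f2≈ : f2 ≈ F M ((- x) ^ 2)
      f2≈ = F-cong M (sym (neg-square x))
      φ-F′ : φ M (- (x ^ 2)) * f4 ≈ f2 ^ 2
      φ-F′ = trans (*-congˡ (F-cong M (sym (^-assocʳ x 2 2)))) (φ-F (small-^ 1 sx))

    -- The product of 1 − xⁱ over i ≡ ±1 (mod 6) is the inverse of the square of O (− x).
    ψ-parts : ∀ {x} → Small x →
              ψ M (- x) ^ 2 * (Q M (- x) (x ^ 6) * Q M (- (x ^ 5)) (x ^ 6) * F M (x ^ 4)) ≈ F M ((x ^ 4) ^ 3)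
    ψ-parts {x} sx = begin
      ψ M (- x) ^ 2 * (u * v * f4)
        ≈⟨ *-congʳ (^-congˡ 2 (trans (ψ-product (small-neg sx)) (*-congˡ (F-cong M (neg-fourth x))))) ⟩
      (o * f4) ^ 2 * (u * v * f4)
        ≈⟨ solve 4 (λ o f4 u v → (o :* f4) :^ 2 :* (u :* v :* f4) := o :^ 2 :* (u :* v) :* f4 :^ 3) refl o f4 u v ⟩
      o ^ 2 * (u * v) * f4 ^ 3
        ≈⟨ *-cong inverse (F-cube (x ^ 4)) ⟩
      1# * F M ((x ^ 4) ^ 3)
        ≈⟨ *-identityˡ _ ⟩
      F M ((x ^ 4) ^ 3) ∎
      where
      open S using (solve; con; _:*_; _:^_; _:=_)
      o u v f4 : Carrier
      o  = O M (- x)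
      u  = Q M (- x) (x ^ 6)
      v  = Q M (- (x ^ 5)) (x ^ 6)
      f4 = F M (x ^ 4)
      x²³≈x⁶ : (x ^ 2) ^ 3 ≈ x ^ 6
      x²³≈x⁶ = ^-assocʳ x 2 3
      -- The odd exponents are sorted modulo 6: the residues 1 and 5 give `u` and `v`, and the
      -- residue 3 gives (x³; x⁶), which is `o ^ 3` in characteristic three. Cancelling one `o` then
      -- yields `inverse`.
      o-split : o ≈ u * o ^ 3 * v
      o-split = begin
        o ≈⟨ Q-cong M refl (neg-square x) ⟩
        Q M (- x) (x ^ 2)
          ≈⟨ Q-split₃ (- x) (small-^ 1 sx) ⟩
        Q M (- x) ((x ^ 2) ^ 3) * Q M (- x * x ^ 2) ((x ^ 2) ^ 3) * Q M (- x * (x ^ 2) ^ 2) ((x ^ 2) ^ 3)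
          ≈⟨ *-cong (*-cong (Q-cong M refl x²³≈x⁶) (Q-cong M (trans (sym (-‿distribˡ-* x (x ^ 2))) (sym (neg-cube x))) (^-congˡ 3 (sym (neg-square x)))))
                    (Q-cong M (trans (sym (-‿distribˡ-* x _)) (-‿cong (*-congˡ (^-assocʳ x 2 2)))) x²³≈x⁶) ⟩
        u * Q M ((- x) ^ 3) (((- x) ^ 2) ^ 3) * v
          ≈⟨ *-congʳ (*-congˡ (Q-cube M (- x) _)) ⟨
        u * o ^ 3 * v ∎
      inverse : o ^ 2 * (u * v) ≈ 1#
      inverse = regular-Q M ((- x) ^ 2) (small-neg sx) (begin
        o * (o ^ 2 * (u * v))   ≈⟨ solve 3 (λ o u v → o :* (o :^ 2 :* (u :* v)) := u :* o :^ 3 :* v) refl o u v ⟩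
        u * o ^ 3 * v           ≈⟨ o-split ⟨
        o                       ≈⟨ *-identityʳ o ⟨
        o * 1#                  ∎)

-- Power series

module PowerSeries {c ℓ} (K : CommutativeRing c ℓ) where
  open CommutativeRing K hiding (zero)
  open SetoidReasoning setoid
  open CommutativeSemigroupProperties +-commutativeSemigroup using (interchange; x∙yz≈y∙xz)

  Series : Set c
  Series = ℕ → Carrier

  infixl 6 _⊕_
  infixl 7 _⊛_
  infix  8 ⊖_

  𝟘 𝟙 q : Series
  𝟘 _ = 0#
  𝟙 zero    = 1#
  𝟙 (suc n) = 0#
  q zero    = 0#
  q (suc n) = 𝟙 n

  ⊖_ : Series → Series
  (⊖ a) n = - a n

  _⊕_ _⊛_ : Series → Series → Series
  (a ⊕ b) n = a n + b n
  (a ⊛ b) zero    = a 0 * b 0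
  (a ⊛ b) (suc n) = a 0 * b (suc n) + ((a ∘ suc) ⊛ b) n

  ⊛-cong : ∀ n {a a′ b b′} → (∀ i → i ≤ n → a i ≈ a′ i) → (∀ i → i ≤ n → b i ≈ b′ i) →
           (a ⊛ b) n ≈ (a′ ⊛ b′) n
  ⊛-cong zero    a≈ b≈ = *-cong (a≈ 0 z≤n) (b≈ 0 z≤n)
  ⊛-cong (suc n) a≈ b≈ = +-cong (*-cong (a≈ 0 z≤n) (b≈ (suc n) ℕₚ.≤-refl))
    (⊛-cong n (λ i i≤n → a≈ (suc i) (s≤s i≤n)) (λ i i≤n → b≈ i (ℕₚ.m≤n⇒m≤1+n i≤n)))

  ⊛-distribʳ : ∀ c a b n → ((a ⊕ b) ⊛ c) n ≈ (a ⊛ c) n + (b ⊛ c) n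
  ⊛-distribʳ c a b zero    = distribʳ _ _ _
  ⊛-distribʳ c a b (suc n) = trans (+-cong (distribʳ _ _ _) (⊛-distribʳ c (a ∘ suc) (b ∘ suc) n)) (interchange _ _ _ _)

  ⊛-zeroˡ : ∀ a n → (𝟘 ⊛ a) n ≈ 0#
  ⊛-zeroˡ a zero    = zeroˡ _
  ⊛-zeroˡ a (suc n) = trans (+-cong (zeroˡ _) (⊛-zeroˡ a n)) (+-identityˡ 0#)

  ⊛-identityˡ : ∀ a n → (𝟙 ⊛ a) n ≈ a n
  ⊛-identityˡ a zero    = *-identityˡ _
  ⊛-identityˡ a (suc n) = trans (+-cong (*-identityˡ _) (⊛-zeroˡ a n)) (+-identityʳ _)

  -- The product is defined by peeling its left factor; peeling the right one as well is what makes
  -- commutativity an induction.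
  ⊛-sucʳ : ∀ a b n → (a ⊛ b) (suc n) ≈ a (suc n) * b 0 + (a ⊛ (b ∘ suc)) n
  ⊛-sucʳ a b zero    = +-comm _ _
  ⊛-sucʳ a b (suc n) = trans (+-congˡ (⊛-sucʳ (a ∘ suc) b n)) (x∙yz≈y∙xz _ _ _)

  ⊛-comm : ∀ a b n → (a ⊛ b) n ≈ (b ⊛ a) n
  ⊛-comm a b zero    = *-comm _ _
  ⊛-comm a b (suc n) = trans (+-cong (*-comm _ _) (⊛-comm (a ∘ suc) b n)) (sym (⊛-sucʳ b a n))

  ⊛-scale : ∀ x a b n → ((λ i → x * a i) ⊛ b) n ≈ x * (a ⊛ b) n
  ⊛-scale x a b zero    = *-assoc _ _ _
  ⊛-scale x a b (suc n) = trans (+-cong (*-assoc _ _ _) (⊛-scale x (a ∘ suc) b n)) (sym (distribˡ _ _ _))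

  ⊛-assoc : ∀ a b c n → ((a ⊛ b) ⊛ c) n ≈ (a ⊛ (b ⊛ c)) n
  ⊛-assoc a b c zero    = *-assoc _ _ _
  ⊛-assoc a b c (suc n) = begin
    a 0 * b 0 * c (suc n) + (((λ i → a 0 * b (suc i)) ⊕ ((a ∘ suc) ⊛ b)) ⊛ c) n
      ≈⟨ +-cong (*-assoc _ _ _) (⊛-distribʳ c (λ i → a 0 * b (suc i)) ((a ∘ suc) ⊛ b) n) ⟩
    a 0 * (b 0 * c (suc n)) + (((λ i → a 0 * b (suc i)) ⊛ c) n + (((a ∘ suc) ⊛ b) ⊛ c) n)
      ≈⟨ +-congˡ (+-cong (⊛-scale (a 0) (b ∘ suc) c n) (⊛-assoc (a ∘ suc) b c n)) ⟩
    a 0 * (b 0 * c (suc n)) + (a 0 * ((b ∘ suc) ⊛ c) n + ((a ∘ suc) ⊛ (b ⊛ c)) n)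
      ≈⟨ +-assoc _ _ _ ⟨
    a 0 * (b 0 * c (suc n)) + a 0 * ((b ∘ suc) ⊛ c) n + ((a ∘ suc) ⊛ (b ⊛ c)) n
      ≈⟨ +-congʳ (distribˡ _ _ _) ⟨
    a 0 * (b ⊛ c) (suc n) + ((a ∘ suc) ⊛ (b ⊛ c)) n ∎

  q-⊛-suc : ∀ a n → (q ⊛ a) (suc n) ≈ a n
  q-⊛-suc a n = trans (+-cong (zeroˡ _) (⊛-identityˡ a n)) (+-identityˡ _)

  infix 4 _≈[_]_
  _≈[_]_ : Series → ℕ → Series → Set ℓ
  a ≈[ N ] b = ∀ n → n < N → a n ≈ b n

  Truncated : ℕ → CommutativeRing c ℓ
  Truncated N = record
    { Carrier = Series
    ; _≈_ = λ a b → a ≈[ N ] b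
    ; _+_ = _⊕_
    ; _*_ = _⊛_
    ; -_  = ⊖_
    ; 0#  = 𝟘
    ; 1#  = 𝟙
    ; isCommutativeRing = record
      { isRing = record
        { +-isAbelianGroup = record
          { isGroup = record
            { isMonoid = record
              { isSemigroup = record
                { isMagma = record
                  { isEquivalence = record
                    { refl  = λ _ _ → refl
                    ; sym   = λ a≈b n n<N → sym (a≈b n n<N)
                    ; trans = λ a≈b b≈c n n<N → trans (a≈b n n<N) (b≈c n n<N)
                    }
                  ; ∙-cong = λ a≈ b≈ n n<N → +-cong (a≈ n n<N) (b≈ n n<N)
                  }
                ; assoc = λ _ _ _ _ _ → +-assoc _ _ _
                }
              ; identity = (λ _ _ _ → +-identityˡ _) , (λ _ _ _ → +-identityʳ _)
              }
            ; inverse = (λ _ _ _ → -‿inverseˡ _) , (λ _ _ _ → -‿inverseʳ _)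
            ; ⁻¹-cong = λ a≈ n n<N → -‿cong (a≈ n n<N)
            }
          ; comm = λ _ _ _ _ → +-comm _ _
          }
        ; *-cong = λ a≈ b≈ n n<N → ⊛-cong n (λ i i≤n → a≈ i (ℕₚ.≤-<-trans i≤n n<N)) (λ i i≤n → b≈ i (ℕₚ.≤-<-trans i≤n n<N))
        ; *-assoc = λ a b c n _ → ⊛-assoc a b c n
        ; *-identity = (λ a n _ → ⊛-identityˡ a n) , (λ a n _ → trans (⊛-comm a 𝟙 n) (⊛-identityˡ a n))
        ; distrib = (λ a b c n _ → trans (⊛-comm a (b ⊕ c) n)
                      (trans (⊛-distribʳ a b c n) (+-cong (⊛-comm b a n) (⊛-comm c a n))))
                  , (λ a b c n _ → ⊛-distribʳ a b c n)
        }
      ; *-comm = λ a b n _ → ⊛-comm a b n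
      }
    }

  module _ (N : ℕ) where
    open Exp (CommutativeRing.commutativeSemiring (Truncated N)) using (_^_)

    q^-⊛-< : ∀ a k n → n < k → ((q ^ k) ⊛ a) n ≈ 0#
    q^-⊛-< a (suc k) n n<1+k = trans (⊛-assoc q (q ^ k) a n) (go n n<1+k)
      where
      go : ∀ n → n < suc k → (q ⊛ ((q ^ k) ⊛ a)) n ≈ 0#
      go zero    _         = zeroˡ _
      go (suc n) (s≤s n<k) = trans (q-⊛-suc _ n) (q^-⊛-< a k n n<k)

    q^-⊛-+ : ∀ a k n → ((q ^ k) ⊛ a) (k ℕ.+ n) ≈ a n
    q^-⊛-+ a zero    n = ⊛-identityˡ a n
    q^-⊛-+ a (suc k) n = trans (⊛-assoc q (q ^ k) a (suc k ℕ.+ n)) (trans (q-⊛-suc _ (k ℕ.+ n)) (q^-⊛-+ a k n))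

    q-small : q ^ N ≈[ N ] 𝟘
    q-small n n<N = trans (sym (trans (⊛-comm (q ^ N) 𝟙 n) (⊛-identityˡ (q ^ N) n))) (q^-⊛-< 𝟙 N n n<N)

  -- Substitution of q³ for q.
  expand : Series → Series
  expand a 0 = a 0
  expand a 1 = 0#
  expand a 2 = 0#
  expand a (suc (suc (suc n))) = expand (a ∘ suc) n

  expand-map₂ : (_∙_ : Carrier → Carrier → Carrier) → 0# ≈ 0# ∙ 0# →
                ∀ a b n → expand (λ i → a i ∙ b i) n ≈ expand a n ∙ expand b n
  expand-map₂ _∙_ eq a b 0 = refl
  expand-map₂ _∙_ eq a b 1 = eq
  expand-map₂ _∙_ eq a b 2 = eq
  expand-map₂ _∙_ eq a b (suc (suc (suc n))) = expand-map₂ _∙_ eq (a ∘ suc) (b ∘ suc) n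

  expand-map : (f : Carrier → Carrier) → 0# ≈ f 0# → ∀ a n → expand (λ i → f (a i)) n ≈ f (expand a n)
  expand-map f eq a n = expand-map₂ (λ x _ → f x) eq a a n

  expand-⊛ : ∀ a b n → expand (a ⊛ b) n ≈ (expand a ⊛ expand b) n
  expand-⊛ a b 0 = refl
  expand-⊛ a b 1 = sym (trans (+-cong (zeroʳ _) (zeroˡ _)) (+-identityˡ 0#))
  expand-⊛ a b 2 = sym (trans (+-cong (zeroʳ _) (trans (+-cong (zeroˡ _) (zeroˡ _)) (+-identityˡ 0#))) (+-identityˡ 0#))
  expand-⊛ a b (suc (suc (suc n))) = begin
    expand ((λ i → a 0 * b (suc i)) ⊕ ((a ∘ suc) ⊛ b)) n
      ≈⟨ expand-map₂ _+_ (sym (+-identityˡ 0#)) _ _ n ⟩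
    expand (λ i → a 0 * b (suc i)) n + expand ((a ∘ suc) ⊛ b) n
      ≈⟨ +-cong (expand-map (a 0 *_) (sym (zeroʳ (a 0))) (b ∘ suc) n) (expand-⊛ (a ∘ suc) b n) ⟩
    a 0 * expand (b ∘ suc) n + (expand (a ∘ suc) ⊛ expand b) n
      ≈⟨ +-congˡ (trans (+-congʳ (zeroˡ _)) (trans (+-identityˡ _) (trans (+-congʳ (zeroˡ _)) (+-identityˡ _)))) ⟨
    (expand a ⊛ expand b) (suc (suc (suc n))) ∎

  expand-𝟘 : ∀ n → expand 𝟘 n ≈ 0#
  expand-𝟘 0 = refl
  expand-𝟘 1 = refl
  expand-𝟘 2 = refl
  expand-𝟘 (suc (suc (suc n))) = expand-𝟘 n

  expand-𝟙 : ∀ n → expand 𝟙 n ≈ 𝟙 n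
  expand-𝟙 0 = refl
  expand-𝟙 1 = refl
  expand-𝟙 2 = refl
  expand-𝟙 (suc (suc (suc n))) = expand-𝟘 n

  expand-cong : ∀ N {a b} → a ≈[ N ] b → expand a ≈[ N ℕ.* 3 ] expand b
  expand-cong (suc N) a≈b 0 _ = a≈b 0 (s≤s z≤n)
  expand-cong (suc N) a≈b 1 _ = refl
  expand-cong (suc N) a≈b 2 _ = refl
  expand-cong (suc N) a≈b (suc (suc (suc n))) (s≤s (s≤s (s≤s n<))) = expand-cong N (λ i i<N → a≈b (suc i) (s≤s i<N)) n n<

  section : ℕ → Series → Series
  section r a n = a (n ℕ.* 3 ℕ.+ r)

  section-cong : ∀ r → r < 3 → ∀ N {a b} → a ≈[ N ℕ.* 3 ] b → section r a ≈[ N ] section r b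
  section-cong r r<3 N a≈b n n<N = a≈b _ (ℕₚ.<-≤-trans (ℕₚ.+-monoʳ-< (n ℕ.* 3) r<3)
    (ℕₚ.≤-trans (ℕₚ.≤-reflexive (ℕₚ.+-comm (n ℕ.* 3) 3)) (ℕₚ.*-monoˡ-≤ 3 n<N)))

  -- A series in `q³` acts as a scalar: only every third coefficient of `expand b` is nonzero, and
  -- passing it moves the index in `a` by 3, which preserves the residue class.
  section-expand : ∀ r → r < 3 → ∀ b a n → section r (expand b ⊛ a) n ≈ (b ⊛ section r a) n
  section-expand 0 _ b a zero = refl
  section-expand 1 _ b a zero = trans (+-congˡ (zeroˡ _)) (+-identityʳ _)
  section-expand 2 _ b a zero = trans (+-congˡ (trans (+-cong (zeroˡ _) (zeroˡ _)) (+-identityˡ 0#))) (+-identityʳ _)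
  section-expand (suc (suc (suc r))) (s≤s (s≤s (s≤s ()))) b a zero
  section-expand r r<3 b a (suc n) = +-congˡ (trans (+-congʳ (zeroˡ _)) (trans (+-identityˡ _)
    (trans (+-congʳ (zeroˡ _)) (trans (+-identityˡ _) (section-expand r r<3 (b ∘ suc) a n)))))

  expand-q : ∀ N → let open Exp (CommutativeRing.commutativeSemiring (Truncated N)) in expand q ≈[ N ] q ^ 3
  expand-q N n _ = go n
    where
    open Exp (CommutativeRing.commutativeSemiring (Truncated N)) using (_^_)
    go : ∀ n → expand q n ≈ (q ^ 3) n
    go 0 = sym (zeroˡ _)
    go 1 = sym (trans (q-⊛-suc (q ^ 2) 0) (zeroˡ _))
    go 2 = sym (trans (q-⊛-suc (q ^ 2) 1) (trans (q-⊛-suc (q ^ 1) 0) (zeroˡ _)))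
    go (suc (suc (suc n))) = trans (expand-𝟙 n) (sym (trans (q-⊛-suc (q ^ 2) (suc (suc n)))
      (trans (q-⊛-suc (q ^ 1) (suc n)) (q-⊛-suc 𝟙 n))))

-- The generating function of dp

-- The period 12 is the least common multiple of 4 and 6.
allowedPart-periodic : ∀ r i → does (allowedPart? (r ℕ.+ i ℕ.* 12)) ≡ does (allowedPart? r)
allowedPart-periodic r i = does-≡ (allowedPart? (r ℕ.+ i ℕ.* 12)) (map′ to from (allowedPart? r))
  where
  4∣12i : 4 ∣ i ℕ.* 12
  4∣12i = ∣n⇒∣m*n i (divides 3 ≡.refl)
  mod6 : (r ℕ.+ i ℕ.* 12) % 6 ≡ r % 6
  mod6 = ≡.trans (≡.cong (λ e → (r ℕ.+ e) % 6) (≡.sym (ℕₚ.*-assoc i 2 6))) ([m+kn]%n≡m%n r (i ℕ.* 2) 6)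
  to : AllowedPart r → AllowedPart (r ℕ.+ i ℕ.* 12)
  to (inj₁ 4∣r)       = inj₁ (∣m∣n⇒∣m+n 4∣r 4∣12i)
  to (inj₂ (inj₁ eq)) = inj₂ (inj₁ (≡.trans mod6 eq))
  to (inj₂ (inj₂ eq)) = inj₂ (inj₂ (≡.trans mod6 eq))
  from : AllowedPart (r ℕ.+ i ℕ.* 12) → AllowedPart r
  from (inj₁ 4∣r+12i)   = inj₁ (∣m+n∣m⇒∣n (≡.subst (4 ∣_) (ℕₚ.+-comm r (i ℕ.* 12)) 4∣r+12i) 4∣12i)
  from (inj₂ (inj₁ eq)) = inj₂ (inj₁ (≡.trans (≡.sym mod6) eq))
  from (inj₂ (inj₂ eq)) = inj₂ (inj₂ (≡.trans (≡.sym mod6) eq))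

module PartProduct {c ℓ} (K : CommutativeRing c ℓ) (N M : ℕ) where
  open PowerSeries K
  open CommutativeRing (Truncated N) hiding (zero)
  open Exp commutativeSemiring
  open FiniteJacobi (Truncated N) using (Q; ∏; ∏-cong; ∏-blocks)
  open Theta (Truncated N)

  partProduct : Series
  partProduct = Q M (- q) (q ^ 6) * Q M (- (q ^ 5)) (q ^ 6) * F M (q ^ 4)

  -- Index `k` stands for the part `k + 1`, hence the extra factor `q`. A forbidden part contributes
  -- 1, so that the product can run over all parts.
  partFactor : ℕ → Series
  partFactor k = if does (allowedPart? (suc k)) then 1# + - q * q ^ k else 1#

  module _ (N≤M : N ≤ M) where
    open Nilpotent (Truncated N) N
    open ThetaProducts (Truncated N) N M N≤M
    open RingProperties ring using (-‿distribˡ-*)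
    open SetoidReasoning setoid

    residue : ℕ → Series
    residue c = Q M (- (q ^ c)) (q ^ 12)

    neg-pow : ∀ a b → - (q ^ a) * q ^ b ≈ - (q ^ (a ℕ.+ b))
    neg-pow a b = trans (sym (-‿distribˡ-* (q ^ a) (q ^ b))) (-‿cong (sym (^-homo-* q a b)))

    column : ∀ r → ∏ M (λ i → partFactor (r ℕ.+ i ℕ.* 12)) ≈ (if does (allowedPart? (suc r)) then residue (suc r) else 1#)
    column r = trans (∏-cong M (λ i → reflexive (≡.cong (λ b → if b then 1# + - q * q ^ (r ℕ.+ i ℕ.* 12) else 1#)
                                                        (allowedPart-periodic (suc r) i))))
                     (go (does (allowedPart? (suc r))))
      where
      go : ∀ b → ∏ M (λ i → if b then 1# + - q * q ^ (r ℕ.+ i ℕ.* 12) else 1#) ≈ (if b then residue (suc r) else 1#)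
      go false = ∏-1 M
      go true  = ∏-cong M (λ i → +-congˡ (begin
        - q * q ^ (r ℕ.+ i ℕ.* 12)          ≈⟨ *-congˡ (^-homo-* q r (i ℕ.* 12)) ⟩
        - q * (q ^ r * q ^ (i ℕ.* 12))      ≈⟨ *-assoc (- q) (q ^ r) (q ^ (i ℕ.* 12)) ⟨
        - q * q ^ r * q ^ (i ℕ.* 12)        ≈⟨ *-cong (sym (-‿distribˡ-* q (q ^ r))) (^-factor q 12 i (ℕₚ.*-comm i 12)) ⟩
        - (q ^ suc r) * (q ^ 12) ^ i        ∎))

    -- Every product is refined to the base q¹²: parts congruent to 1 modulo 6 fall into the classes
    -- 1 and 7, those congruent to 5 into 5 and 11, and multiples of 4 into 4, 8 and 12. These
    -- classes are distinct, so no part is counted twice.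
    partProduct-residues : partProduct ≈
      residue 1 * residue 7 * (residue 5 * residue 11) * (residue 4 * residue 8 * residue 12)
    partProduct-residues = *-cong (*-cong
      (trans (Q-split₂ (- q) s₆) (*-cong (Q-cong M q≈ (^-assocʳ q 6 2)) (Q-cong M (sym (-‿distribˡ-* q (q ^ 6))) (^-assocʳ q 6 2))))
      (trans (Q-split₂ (- (q ^ 5)) s₆) (*-cong (Q-cong M refl (^-assocʳ q 6 2)) (Q-cong M (neg-pow 5 6) (^-assocʳ q 6 2)))))
      (trans (Q-split₃ (- (q ^ 4)) s₄) (*-cong (*-cong (Q-cong M refl (^-assocʳ q 4 3)) (Q-cong M (neg-pow 4 4) (^-assocʳ q 4 3)))
        (Q-cong M (trans (*-congˡ (^-assocʳ q 4 2)) (neg-pow 4 8)) (^-assocʳ q 4 3))))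
      where
      s₆ : Small (q ^ 6)
      s₆ = small-^ 5 (q-small N)
      s₄ : Small (q ^ 4)
      s₄ = small-^ 3 (q-small N)
      q≈ : - q ≈ - (q ^ 1)
      q≈ = -‿cong (sym (*-identityʳ q))

    ∏-partFactor : ∏ (M ℕ.* 12) partFactor ≈ partProduct
    ∏-partFactor = begin
      ∏ (M ℕ.* 12) partFactor                                              ≈⟨ ∏-blocks M 12 partFactor ⟩
      ∏ M (λ i → ∏ 12 (λ r → partFactor (r ℕ.+ i ℕ.* 12)))                 ≈⟨ ∏-swap M 12 (λ i r → partFactor (r ℕ.+ i ℕ.* 12)) ⟩
      ∏ 12 (λ r → ∏ M (λ i → partFactor (r ℕ.+ i ℕ.* 12)))                 ≈⟨ ∏-cong 12 column ⟩
      ∏ 12 (λ r → if does (allowedPart? (suc r)) then residue (suc r) else 1#)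
        -- The remaining residues 2, 3, 6, 9 and 10 consist of forbidden parts and contribute 1.
        ≈⟨ regroup (residue 1) (residue 4) (residue 5) (residue 7) (residue 8) (residue 11) (residue 12) ⟩
      residue 1 * residue 7 * (residue 5 * residue 11) * (residue 4 * residue 8 * residue 12)
        ≈⟨ partProduct-residues ⟨
      partProduct ∎
      where
      open NaturalCoefficients commutativeSemiring
      regroup : ∀ a d e g h k l → 1# * a * 1# * 1# * d * e * 1# * g * h * 1# * 1# * k * l ≈
                                  a * g * (e * k) * (d * h * l)
      regroup = solve 7 (λ a d e g h k l → con 1 :* a :* con 1 :* con 1 :* d :* e :* con 1 :* g :* h :* con 1 :* con 1 :* k :* l :=
                                           a :* g :* (e :* k) :* (d :* h :* l)) refl

-- Finite sums and products of powers pass through any ring homomorphism. Taken for `expand`, this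
-- recognises a theta series in `q³` as an image of `expand`, the form in which `section-expand` can
-- pull it out.
module ThetaHomomorphism {c₁ ℓ₁ c₂ ℓ₂} (R : CommutativeRing c₁ ℓ₁) (S : CommutativeRing c₂ ℓ₂)
  {h : CommutativeRing.Carrier R → CommutativeRing.Carrier S}
  (isHom : IsRingHomomorphism (CommutativeRing.rawRing R) (CommutativeRing.rawRing S) h) where
  open CommutativeRing S hiding (zero)
  open IsRingHomomorphism isHom
  open Exp commutativeSemiring
  private
    module R  = CommutativeRing R
    module Rₑ = Exp R.commutativeSemiring
    module Rᶠ = FiniteJacobi R
    module Rᶿ = Theta R
  open FiniteJacobi S
  open Theta S

  ^-hom : ∀ {x y} n → h x ≈ y → h (x Rₑ.^ n) ≈ y ^ n
  ^-hom zero    hx≈y = 1#-homo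
  ^-hom (suc n) hx≈y = trans (*-homo _ _) (*-cong hx≈y (^-hom n hx≈y))

  ∑-hom : ∀ n {g g′} → (∀ i → h (g i) ≈ g′ i) → h (Rᶠ.∑ n g) ≈ ∑ n g′
  ∑-hom zero    eq = 0#-homo
  ∑-hom (suc n) eq = trans (+-homo _ _) (+-cong (∑-hom n eq) (eq n))

  ∏-hom : ∀ n {g g′} → (∀ i → h (g i) ≈ g′ i) → h (Rᶠ.∏ n g) ≈ ∏ n g′
  ∏-hom zero    eq = 1#-homo
  ∏-hom (suc n) eq = trans (*-homo _ _) (*-cong (∏-hom n eq) (eq n))

  module _ {x y} (hx≈y : h x ≈ y) where

    ψ-hom : ∀ n → h (Rᶿ.ψ n x) ≈ ψ n y
    ψ-hom n = ∑-hom n (λ i → ^-hom (τ (suc i)) hx≈y)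

    φ-hom : ∀ n → h (Rᶿ.φ n x) ≈ φ n y
    φ-hom n = ∑-hom n (λ i → trans (+-homo _ _) (+-cong (^-hom (i ℕ.* i) hx≈y) (^-hom (suc i ℕ.* suc i) hx≈y)))

    A-hom : ∀ n → h (Rᶿ.A n x) ≈ A n y
    A-hom n = ∑-hom n (λ i → trans (+-homo _ _) (+-cong (^-hom (α⁺ i) hx≈y) (^-hom (α⁻ i) hx≈y)))

    G-hom : ∀ n → h (Rᶿ.G n x) ≈ G n y
    G-hom n = ∑-hom n (λ i → trans (+-homo _ _) (+-cong (twice (^-hom (γ₁ i) hx≈y)) (twice (^-hom (γ₂ i) hx≈y))))
      where
      twice : ∀ {u v} → h u ≈ v → h (u R.+ u) ≈ v + v
      twice eq = trans (+-homo _ _) (+-cong eq eq)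

    F-hom : ∀ n → h (Rᶿ.F n x) ≈ F n y
    F-hom n = ∏-hom n (λ i → trans (+-homo _ _) (+-cong 1#-homo
      (trans (*-homo _ _) (*-cong (trans (-‿homo _) (-‿cong hx≈y)) (^-hom i hx≈y)))))

-- Sections of dissected series

module Trisection {c ℓ} (K : CommutativeRing c ℓ) where
  open CommutativeRing K hiding (zero)
  open PowerSeries K
  open RingProperties ring using (-0#≈0#)

  expand-isRingHomomorphism : ∀ N → IsRingHomomorphism
    (CommutativeRing.rawRing (Truncated N)) (CommutativeRing.rawRing (Truncated (N ℕ.* 3))) expand
  expand-isRingHomomorphism N = record
    { isSemiringHomomorphism = record
      { isNearSemiringHomomorphism = record
        { +-isMonoidHomomorphism = record
          { isMagmaHomomorphism = record
            { isRelHomomorphism = record { cong = expand-cong N }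
            ; homo = λ a b n _ → expand-map₂ _+_ (sym (+-identityˡ 0#)) a b n
            }
          ; ε-homo = λ n _ → expand-𝟘 n
          }
        ; *-homo = λ a b n _ → expand-⊛ a b n
        }
      ; 1#-homo = λ n _ → expand-𝟙 n
      }
    ; -‿homo = λ a n _ → expand-map -_ (sym -0#≈0#) a n
    }

  section-linear : ∀ r → r < 3 → ∀ N a b y →
    section r (expand a ⊕ y ⊛ expand b) ≈[ N ] a ⊛ section r 𝟙 ⊕ b ⊛ section r y
  section-linear r r<3 N a b y n _ = +-cong
    (trans (sym (trans (⊛-comm (expand a) 𝟙 (n ℕ.* 3 ℕ.+ r)) (⊛-identityˡ (expand a) (n ℕ.* 3 ℕ.+ r)))) (section-expand r r<3 a 𝟙 n))
    (trans (⊛-comm y (expand b) (n ℕ.* 3 ℕ.+ r)) (section-expand r r<3 b y n))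

  -- The summands of the square are images of `expand` times 1, `y` and `y ⊛ y`, so the section has
  -- to be known only on these three.
  section-square : ∀ r → r < 3 → ∀ N a b y → let s = expand a ⊕ y ⊛ expand b in
    section r (s ⊛ s) ≈[ N ] a ⊛ a ⊛ section r 𝟙 ⊕ (a ⊛ b ⊕ a ⊛ b) ⊛ section r y ⊕ b ⊛ b ⊛ section r (y ⊛ y)
  section-square r r<3 N a b y n n<N = trans
    (section-cong r r<3 N (T.trans (regroup (expand a) (expand b) y) (T.+-cong (T.+-cong
      (T.*-congʳ (T.sym (*-homo a a)))
      (T.*-congʳ (T.trans (T.+-cong (T.sym (*-homo a b)) (T.sym (*-homo a b))) (T.sym (+-homo (a ⊛ b) (a ⊛ b))))))
      (T.*-congʳ (T.sym (*-homo b b))))) n n<N)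
    (+-cong (+-cong (section-expand r r<3 (a ⊛ a) 𝟙 n) (section-expand r r<3 (a ⊛ b ⊕ a ⊛ b) y n))
            (section-expand r r<3 (b ⊛ b) (y ⊛ y) n))
    where
    module T = CommutativeRing (Truncated (N ℕ.* 3))
    open IsRingHomomorphism (expand-isRingHomomorphism N)
    regroup : ∀ a b y → (a ⊕ y ⊛ b) ⊛ (a ⊕ y ⊛ b) T.≈ a ⊛ a ⊛ 𝟙 ⊕ (a ⊛ b ⊕ a ⊛ b) ⊛ y ⊕ b ⊛ b ⊛ (y ⊛ y)
    regroup = solve 3 (λ a b y → (a :+ y :* b) :* (a :+ y :* b) :=
                a :* a :* con 1 :+ (a :* b :+ a :* b) :* y :+ b :* b :* (y :* y)) T.refl
      where open NaturalCoefficients T.commutativeSemiring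

  section-1-𝟙 : ∀ n → section 1 𝟙 n ≈ 0#
  section-1-𝟙 zero    = refl
  section-1-𝟙 (suc n) = refl

  section-2-𝟙 : ∀ n → section 2 𝟙 n ≈ 0#
  section-2-𝟙 zero    = refl
  section-2-𝟙 (suc n) = refl

  section-0-𝟙 : ∀ n → section 0 𝟙 n ≈ 𝟙 n
  section-0-𝟙 zero    = refl
  section-0-𝟙 (suc n) = refl

  section-1-q : ∀ n → section 1 q n ≈ 𝟙 n
  section-1-q zero    = refl
  section-1-q (suc n) = refl

  section-2-q : ∀ n → section 2 q n ≈ 0#
  section-2-q zero    = refl
  section-2-q (suc n) = refl

  section-0-q² : ∀ n → section 0 (q ⊛ q) n ≈ 0#
  section-0-q² zero    = zeroˡ _
  section-0-q² (suc n) = q-⊛-suc q (suc (suc (n ℕ.* 3 ℕ.+ 0)))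

  section-1-q² : ∀ n → section 1 (q ⊛ q) n ≈ 0#
  section-1-q² zero    = q-⊛-suc q 0
  section-1-q² (suc n) = q-⊛-suc q (suc (suc (n ℕ.* 3 ℕ.+ 1)))

  section-2-q² : ∀ n → section 2 (q ⊛ q) n ≈ 𝟙 n
  section-2-q² zero    = q-⊛-suc q 1
  section-2-q² (suc n) = q-⊛-suc q (suc (suc (n ℕ.* 3 ℕ.+ 2)))

ThreeIsZero : ∀ {k ℓ} → CommutativeRing k ℓ → Set ℓ
ThreeIsZero K = 1# + (1# + 1#) ≈ 0#
  where open CommutativeRing K

-- The chain of sections

module Congruence {k ℓ} (K : CommutativeRing k ℓ) (1+1+1≈0 : ThreeIsZero K) where
  private module K = CommutativeRing K
  open PowerSeries K
  open Trisection K
  open PartProduct K using (partProduct)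

  3≈0 : ∀ N → 𝟙 ⊕ (𝟙 ⊕ 𝟙) ≈[ N ] 𝟘
  3≈0 N zero    _ = 1+1+1≈0
  3≈0 N (suc n) _ = K.trans (K.+-identityˡ _) (K.+-identityˡ _)

  module _ (N M : ℕ) where
    open CommutativeRing (Truncated N)
    open Exp commutativeSemiring
    open Theta (Truncated N)

    -- Truncations of ψ(q)² φ(-q⁶) and ψ(q³)² φ(-q²). The argument -q⁶ is kept as the cube of -q²,
    -- the form that `A-ψ` and `φ-dissect` deliver.
    X Y : Series
    X = ψ M q ^ 2 * φ M ((- (q ^ 2)) ^ 3)
    Y = ψ M (q ^ 3) ^ 2 * φ M (- (q ^ 2))

  module TruncatedSections (N M : ℕ) (3N≤M : N ℕ.* 3 ≤ M) where

    N≤M : N ≤ M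
    N≤M = ℕₚ.≤-trans (ℕₚ.m≤m*n N 3) 3N≤M

    private
      module T  = CommutativeRing (Truncated N)
      module Tₑ = Exp T.commutativeSemiring
      module Tᶿ = Theta (Truncated N)
      module Tₚ = ThetaProducts (Truncated N) N M N≤M
      module Tₙ = Nilpotent (Truncated N) N
    open CommutativeRing (Truncated (N ℕ.* 3)) hiding (zero)
    open Exp commutativeSemiring
    open Theta (Truncated (N ℕ.* 3))
    open Nilpotent (Truncated (N ℕ.* 3)) (N ℕ.* 3)
    open ThetaProducts (Truncated (N ℕ.* 3)) (N ℕ.* 3) M 3N≤M
    open ThetaHomomorphism (Truncated N) (Truncated (N ℕ.* 3)) (expand-isRingHomomorphism N)
    open IsRingHomomorphism (expand-isRingHomomorphism N)

    small-q : Small q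
    small-q = q-small (N ℕ.* 3)

    expand-q³ : expand q ≈ q ^ 3
    expand-q³ = expand-q (N ℕ.* 3)

    expand-neg-q³ : expand (- q) ≈ (- q) ^ 3
    expand-neg-q³ = trans (-‿homo q) (trans (-‿cong expand-q³) (sym (neg-cube q)))

    y : Series
    y = - (q ^ 2)

    expand-y : expand (T.- (q Tₑ.^ 2)) ≈ y ^ 3
    expand-y = trans (-‿homo (q Tₑ.^ 2)) (trans (-‿cong (trans (^-hom 2 expand-q³) (^-comm q 3 2))) (sym (neg-cube (q ^ 2))))

    -- Serves both `x = q` and `x = - q`: `z` is the series from which substituting q³ for `q`
    -- produces `x ^ 3`.
    ψ-dissect : ∀ {x z} → Small x → expand z ≈ x ^ 3 → ψ M x ≈ expand (Tᶿ.A M z) ⊕ x ⊛ expand (Tᶿ.ψ M (z Tₑ.^ 3))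
    ψ-dissect {x} {z} sx eq = trans (sym (ψ-stable (ℕₚ.m≤m*n M 3) sx)) (trans (ψ-trisection M x)
      (+-cong (sym (A-hom eq M)) (*-congˡ (sym (ψ-hom (trans (^-hom 3 eq) (^-assocʳ x 3 3)) M)))))

    φ-dissect : φ M y ≈ expand (Tᶿ.φ M ((T.- (q Tₑ.^ 2)) Tₑ.^ 3)) ⊕ y ⊛ expand (Tᶿ.G M (T.- (q Tₑ.^ 2)))
    φ-dissect = trans (sym (φ-stable (ℕₚ.m≤m*n M 3) sy)) (trans (φ-trisection M y)
      (+-cong (sym (φ-hom (trans (^-hom 3 expand-y) (^-assocʳ y 3 3)) M)) (*-congˡ (sym (G-hom expand-y M)))))
      where
      sy : Small y
      sy = small-neg (small-^ 1 small-q)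

    -- Multiplying `ψ-parts` by `D`, the inverse of the product over the parts, leaves f_12 D =
    -- ψ(-q)², and f_12 is the image of f_4 under `expand`.
    gf-square : ∀ D → D ⊛ partProduct (N ℕ.* 3) M ≈ 𝟙 →
                let s = expand (Tᶿ.A M (T.- q)) ⊕ (- q) ⊛ expand (Tᶿ.ψ M ((T.- q) Tₑ.^ 3)) in
                expand (Tᶿ.F M (q Tₑ.^ 4)) ⊛ D ≈ s ⊛ s
    gf-square D D⊛P≈1 = begin
      expand (Tᶿ.F M (q Tₑ.^ 4)) ⊛ D       ≈⟨ *-congʳ (F-hom (trans (^-hom 4 expand-q³) (^-comm q 3 4)) M) ⟩
      F M ((q ^ 4) ^ 3) ⊛ D                ≈⟨ *-congʳ (Characteristic3.ψ-parts (3≈0 (N ℕ.* 3)) small-q) ⟨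
      ψ M (- q) ^ 2 ⊛ P ⊛ D                ≈⟨ *-assoc (ψ M (- q) ^ 2) P D ⟩
      ψ M (- q) ^ 2 ⊛ (P ⊛ D)              ≈⟨ *-congˡ (trans (*-comm P D) D⊛P≈1) ⟩
      ψ M (- q) ^ 2 ⊛ 𝟙                    ≈⟨ *-identityʳ (ψ M (- q) ^ 2) ⟩
      ψ M (- q) ⊛ (ψ M (- q) ⊛ 𝟙)          ≈⟨ *-cong ψ≈ (trans (*-identityʳ (ψ M (- q))) ψ≈) ⟩
      _                                    ∎
      where
      open SetoidReasoning setoid
      P : Series
      P = partProduct (N ℕ.* 3) M
      ψ≈ : ψ M (- q) ≈ expand (Tᶿ.A M (T.- q)) ⊕ (- q) ⊛ expand (Tᶿ.ψ M ((T.- q) Tₑ.^ 3))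
      ψ≈ = ψ-dissect (small-neg small-q) expand-neg-q³

    -- In the square from `gf-square` only the cross term has exponents 3n + 1, and the factor f_12
    -- passes through the section as f_4. `A-ψ` produces the same f_4 on the other side, where it
    -- cancels.
    section-gf : ∀ D → D ⊛ partProduct (N ℕ.* 3) M ≈ 𝟙 → section 1 D ≈[ N ] X N M
    section-gf D D⊛P≈1 = Tₚ.regular-F (Tₙ.small-* _ (q-small N)) (begin
      f₄ ⊛ section 1 D                 ≈⟨ (λ n _ → section-expand 1 1<3 f₄ D n) ⟨
      section 1 (expand f₄ ⊛ D)        ≈⟨ section-cong 1 1<3 N (gf-square D D⊛P≈1) ⟩
      section 1 (s ⊛ s)                ≈⟨ section-square 1 1<3 N a b (- q) ⟩
      a ⊛ a ⊛ section 1 𝟙 ⊕ (a ⊛ b ⊕ a ⊛ b) ⊛ section 1 (- q) ⊕ b ⊛ b ⊛ section 1 ((- q) ⊛ (- q))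
        ≈⟨ T.+-cong (T.+-cong (T.*-congˡ (λ n _ → section-1-𝟙 n)) (T.*-congˡ section-neg-q)) (T.*-congˡ section-neg-q²) ⟩
      a ⊛ a ⊛ 𝟘 ⊕ (a ⊛ b ⊕ a ⊛ b) ⊛ (𝟙 ⊕ 𝟙) ⊕ b ⊛ b ⊛ 𝟘
        ≈⟨ regroup a b ⟩
      a ⊛ b ⊕ (𝟙 ⊕ (𝟙 ⊕ 𝟙)) ⊛ (a ⊛ b)  ≈⟨ T.+-congˡ {x = a ⊛ b} (T.trans (T.*-congʳ {x = a ⊛ b} (3≈0 N)) (T.zeroˡ (a ⊛ b))) ⟩
      a ⊛ b ⊕ 𝟘                        ≈⟨ T.+-identityʳ _ ⟩
      a ⊛ b                            ≈⟨ Tₚ.Characteristic3.A-ψ (3≈0 N) (q-small N) ⟩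
      f₄ ⊛ (Tᶿ.ψ M q Tₑ.^ 2) ⊛ Tᶿ.φ M ((T.- (q Tₑ.^ 2)) Tₑ.^ 3) ≈⟨ T.*-assoc f₄ _ _ ⟩
      f₄ ⊛ X N M                       ∎)
      where
      open SetoidReasoning T.setoid
      1<3 : 1 < 3
      1<3 = s≤s (s≤s z≤n)
      f₄ a b s : Series
      f₄ = Tᶿ.F M (q Tₑ.^ 4)
      a  = Tᶿ.A M (T.- q)
      b  = Tᶿ.ψ M ((T.- q) Tₑ.^ 3)
      s  = expand a ⊕ (- q) ⊛ expand b
      -- Writing -1 as 1 + 1 keeps the identity within the reach of a solver with natural
      -- coefficients: the cross term becomes 4 a b = a b + 3 a b.
      section-neg-q : section 1 (- q) ≈[ N ] 𝟙 ⊕ 𝟙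
      section-neg-q = T.trans (λ n _ → K.-‿cong (section-1-q n)) (T.sym (inverseʳ-unique 𝟙 (𝟙 ⊕ 𝟙) (3≈0 N)))
        where open GroupProperties T.+-group using (inverseʳ-unique)
      section-neg-q² : section 1 ((- q) ⊛ (- q)) ≈[ N ] 𝟘
      section-neg-q² = T.trans (section-cong 1 1<3 N (-x*-y≈x*y q q)) (λ n _ → section-1-q² n)
      regroup : ∀ a b → a ⊛ a ⊛ 𝟘 ⊕ (a ⊛ b ⊕ a ⊛ b) ⊛ (𝟙 ⊕ 𝟙) ⊕ b ⊛ b ⊛ 𝟘 T.≈ a ⊛ b ⊕ (𝟙 ⊕ (𝟙 ⊕ 𝟙)) ⊛ (a ⊛ b)
      regroup = solve 2 (λ a b → a :* a :* con 0 :+ (a :* b :+ a :* b) :* (con 1 :+ con 1) :+ b :* b :* con 0 :=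
                                 a :* b :+ (con 1 :+ (con 1 :+ con 1)) :* (a :* b)) T.refl
        where open NaturalCoefficients T.commutativeSemiring

    -- The factor φ(-q⁶) is a series in q³ and can be pulled out. In the square of A(q³) + q ψ(q⁹)
    -- only q² ψ(q⁹)² has exponents 3n + 2.
    section-X : section 2 (X (N ℕ.* 3) M) ≈[ N ] Y N M
    section-X = begin
      section 2 (X (N ℕ.* 3) M)                ≈⟨ section-cong 2 2<3 N X≈ ⟩
      section 2 (expand c ⊛ (s ⊛ s))           ≈⟨ (λ n _ → section-expand 2 2<3 c (s ⊛ s) n) ⟩
      c ⊛ section 2 (s ⊛ s)                    ≈⟨ T.*-congˡ (section-square 2 2<3 N a b q) ⟩
      c ⊛ (a ⊛ a ⊛ section 2 𝟙 ⊕ (a ⊛ b ⊕ a ⊛ b) ⊛ section 2 q ⊕ b ⊛ b ⊛ section 2 (q ⊛ q))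
        ≈⟨ T.*-congˡ (T.+-cong (T.+-cong (T.*-congˡ (λ n _ → section-2-𝟙 n)) (T.*-congˡ (λ n _ → section-2-q n)))
                               (T.*-congˡ (λ n _ → section-2-q² n))) ⟩
      c ⊛ (a ⊛ a ⊛ 𝟘 ⊕ (a ⊛ b ⊕ a ⊛ b) ⊛ 𝟘 ⊕ b ⊛ b ⊛ 𝟙)
        ≈⟨ regroup a b c ⟩
      b ⊛ (b ⊛ 𝟙) ⊛ c                          ∎
      where
      open SetoidReasoning T.setoid
      2<3 : 2 < 3
      2<3 = s≤s (s≤s (s≤s z≤n))
      a b c s : Series
      a = Tᶿ.A M q
      b = Tᶿ.ψ M (q Tₑ.^ 3)
      c = Tᶿ.φ M (T.- (q Tₑ.^ 2))
      s = expand a ⊕ q ⊛ expand b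
      ψ≈s : ψ M q ≈ s
      ψ≈s = ψ-dissect small-q expand-q³
      X≈ : X (N ℕ.* 3) M ≈ expand c ⊛ (s ⊛ s)
      X≈ = trans (*-cong (*-cong ψ≈s (trans (*-identityʳ _) ψ≈s)) (sym (φ-hom expand-y M))) (*-comm _ _)
      regroup : ∀ a b c → c ⊛ (a ⊛ a ⊛ 𝟘 ⊕ (a ⊛ b ⊕ a ⊛ b) ⊛ 𝟘 ⊕ b ⊛ b ⊛ 𝟙) T.≈ b ⊛ (b ⊛ 𝟙) ⊛ c
      regroup = solve 3 (λ a b c → c :* (a :* a :* con 0 :+ (a :* b :+ a :* b) :* con 0 :+ b :* b :* con 1) :=
                                 b :* (b :* con 1) :* c) T.refl
        where open NaturalCoefficients T.commutativeSemiring

    -- Now ψ(q³)² is pulled out. In the dissection of φ(-q²) the second summand carries the factor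
    -- -q², so its exponents are 2 modulo 3 and only φ(-q¹⁸) survives.
    section-Y : section 0 (Y (N ℕ.* 3) M) ≈[ N ] X N M
    section-Y = begin
      section 0 (Y (N ℕ.* 3) M)                         ≈⟨ section-cong 0 0<3 N Y≈ ⟩
      section 0 (expand a² ⊛ (expand b ⊕ y ⊛ expand g)) ≈⟨ (λ n _ → section-expand 0 0<3 a² _ n) ⟩
      a² ⊛ section 0 (expand b ⊕ y ⊛ expand g)          ≈⟨ T.*-congˡ (section-linear 0 0<3 N b g y) ⟩
      a² ⊛ (b ⊛ section 0 𝟙 ⊕ g ⊛ section 0 y)          ≈⟨ T.*-congˡ (T.+-cong (T.*-congˡ (λ n _ → section-0-𝟙 n)) (T.*-congˡ section-y)) ⟩
      a² ⊛ (b ⊛ 𝟙 ⊕ g ⊛ 𝟘)                              ≈⟨ T.*-congˡ (T.trans (T.+-cong (T.*-identityʳ b) (T.zeroʳ g)) (T.+-identityʳ b)) ⟩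
      a² ⊛ b                                            ∎
      where
      open SetoidReasoning T.setoid
      0<3 : 0 < 3
      0<3 = s≤s z≤n
      a² b g : Series
      a² = Tᶿ.ψ M q Tₑ.^ 2
      b  = Tᶿ.φ M ((T.- (q Tₑ.^ 2)) Tₑ.^ 3)
      g  = Tᶿ.G M (T.- (q Tₑ.^ 2))
      Y≈ : Y (N ℕ.* 3) M ≈ expand a² ⊛ (expand b ⊕ y ⊛ expand g)
      Y≈ = *-cong (sym (^-hom 2 (ψ-hom expand-q³ M))) φ-dissect
      section-y : section 0 y ≈[ N ] 𝟘
      section-y n n<N = K.trans (K.-‿cong (K.trans (section-cong 0 0<3 N (*-congˡ {x = q} (*-identityʳ q)) n n<N) (section-0-q² n))) -0#≈0#
        where open RingProperties K.ring using (-0#≈0#)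

  gf-congruence : ∀ D → (∀ N M → N ≤ M → D ⊛ partProduct N M ≈[ N ] 𝟙) →
                  ∀ n → section 0 (section 2 (section 1 D)) n K.≈ section 1 D n
  gf-congruence D D⊛P≈1 n = trans (section-cong 0 0<3 N 9n+2) (trans S₁.section-Y (sym (S₁.section-gf D (D⊛P≈1 _ M 3N≤M)))) n ℕₚ.≤-refl
    where
    N M : ℕ
    -- The coefficient of index `n` is visible modulo `q^N` for `N = n + 1`. Each of the three
    -- sections divides the precision by 3, so the start is at precision `27 N`, which is also the
    -- common number of terms `M`.
    N = suc n
    M = N ℕ.* 3 ℕ.* 3 ℕ.* 3
    open CommutativeRing (Truncated N) using (trans; sym)
    module T₃ = CommutativeRing (Truncated (N ℕ.* 3))
    9N≤M : N ℕ.* 3 ℕ.* 3 ≤ M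
    9N≤M = ℕₚ.m≤m*n _ 3
    3N≤M : N ℕ.* 3 ≤ M
    3N≤M = ℕₚ.≤-trans (ℕₚ.m≤m*n _ 3) 9N≤M
    module S₁ = TruncatedSections N M 3N≤M
    module S₃ = TruncatedSections (N ℕ.* 3) M 9N≤M
    module S₉ = TruncatedSections (N ℕ.* 3 ℕ.* 3) M ℕₚ.≤-refl
    0<3 : 0 < 3
    0<3 = s≤s z≤n
    2<3 : 2 < 3
    2<3 = s≤s (s≤s (s≤s z≤n))
    9n+2 : section 2 (section 1 D) ≈[ N ℕ.* 3 ] Y (N ℕ.* 3) M
    9n+2 = T₃.trans (section-cong 2 2<3 (N ℕ.* 3) (S₉.section-gf D (D⊛P≈1 _ M ℕₚ.≤-refl))) S₃.section-X

-- The field with three elements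

infixl 6 _+₃_
infixl 7 _*₃_
_+₃_ _*₃_ : Fin 3 → Fin 3 → Fin 3
x +₃ y = (toℕ x ℕ.+ toℕ y) mod 3
x *₃ y = (toℕ x ℕ.* toℕ y) mod 3

-- Modulo 3 the negative of `x` is `2 x`.
-₃_ : Fin 3 → Fin 3
-₃ x = x +₃ x

𝔽₃ : CommutativeRing 0ℓ 0ℓ
𝔽₃ = record
  { Carrier = Fin 3
  ; _≈_ = _≡_
  ; _+_ = _+₃_
  ; _*_ = _*₃_
  ; -_  = -₃_
  ; 0#  = zero
  ; 1#  = suc zero
  ; isCommutativeRing = record
    { isRing = record
      { +-isAbelianGroup = record
        { isGroup = record
          { isMonoid = record
            { isSemigroup = record
              { isMagma = record { isEquivalence = ≡.isEquivalence ; ∙-cong = ≡.cong₂ _+₃_ }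
              ; assoc = from-yes (allFin? λ x → allFin? λ y → allFin? λ z → (x +₃ y) +₃ z ≟ᶠ x +₃ (y +₃ z))
              }
            ; identity = from-yes (allFin? λ x → zero +₃ x ≟ᶠ x) , from-yes (allFin? λ x → x +₃ zero ≟ᶠ x)
            }
          ; inverse = from-yes (allFin? λ x → (-₃ x) +₃ x ≟ᶠ zero) , from-yes (allFin? λ x → x +₃ (-₃ x) ≟ᶠ zero)
          ; ⁻¹-cong = ≡.cong -₃_
          }
        ; comm = from-yes (allFin? λ x → allFin? λ y → x +₃ y ≟ᶠ y +₃ x)
        }
      ; *-cong = ≡.cong₂ _*₃_
      ; *-assoc = from-yes (allFin? λ x → allFin? λ y → allFin? λ z → (x *₃ y) *₃ z ≟ᶠ x *₃ (y *₃ z))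
      ; *-identity = from-yes (allFin? λ x → suc zero *₃ x ≟ᶠ x) , from-yes (allFin? λ x → x *₃ suc zero ≟ᶠ x)
      ; distrib = from-yes (allFin? λ x → allFin? λ y → allFin? λ z → x *₃ (y +₃ z) ≟ᶠ x *₃ y +₃ x *₃ z)
                , from-yes (allFin? λ x → allFin? λ y → allFin? λ z → (y +₃ z) *₃ x ≟ᶠ y *₃ x +₃ z *₃ x)
      }
    ; *-comm = from-yes (allFin? λ x → allFin? λ y → x *₃ y ≟ᶠ y *₃ x)
    }
  }

toℕ-mod : ∀ m → toℕ (m mod 3) ≡ m % 3
toℕ-mod m = toℕ-fromℕ< _

mod-+ : ∀ m n → (m ℕ.+ n) mod 3 ≡ (m mod 3) +₃ (n mod 3)
mod-+ m n = toℕ-injective (≡.trans (toℕ-fromℕ< _) (≡.trans (%-distribˡ-+ m n 3)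
  (≡.sym (≡.trans (toℕ-fromℕ< _) (≡.cong₂ (λ x y → (x ℕ.+ y) % 3) (toℕ-mod m) (toℕ-mod n))))))

-- Counting partitions by their largest part

partitionsUpTo-< : ∀ k n → n < suc k → partitionsUpTo (suc k) n ≡ partitionsUpTo k n
partitionsUpTo-< k n n<1+k rewrite m<n⇒m/n≡0 n<1+k =
  ≡.trans (++-identityʳ _) (map-id (partitionsUpTo k n))

-- The multiplicity of the part `k + 1` is either 0 or a successor, and in the second case one copy
-- of the part can be taken off. This turns the grouping by multiplicities into a recurrence.
partitionsUpTo-+ : ∀ k n → partitionsUpTo (suc k) (suc k ℕ.+ n) ≡
                   partitionsUpTo k (suc k ℕ.+ n) ++ map (suc k ∷_) (partitionsUpTo (suc k) n)
partitionsUpTo-+ k n = begin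
  concatMap f (upTo (suc ((p ℕ.+ n) / p)))
    ≡⟨ ≡.cong (λ t → concatMap f (upTo (suc t))) (≡.trans (+-distrib-/-∣ˡ n (∣-refl {p})) (≡.cong (ℕ._+ n / p) (n/n≡1 p))) ⟩
  map id (partitionsUpTo k (p ℕ.+ n)) ++ concatMap f (applyUpTo suc (suc (n / p)))
    ≡⟨ ≡.cong₂ _++_ (map-id (partitionsUpTo k (p ℕ.+ n))) (≡.cong (concatMap f) (≡.sym (map-applyUpTo id suc (suc (n / p))))) ⟩
  partitionsUpTo k (p ℕ.+ n) ++ concatMap f (map suc (upTo (suc (n / p))))
    ≡⟨ ≡.cong (partitionsUpTo k (p ℕ.+ n) ++_) (begin
      concatMap f (map suc (upTo (suc (n / p))))                ≡⟨ concatMap-map f suc (upTo (suc (n / p))) ⟩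
      concatMap (f ∘ suc) (upTo (suc (n / p)))                  ≡⟨ concatMap-cong shift (upTo (suc (n / p))) ⟩
      concatMap (map (p ∷_) ∘ g) (upTo (suc (n / p)))           ≡⟨ map-concatMap (p ∷_) g (upTo (suc (n / p))) ⟨
      map (p ∷_) (partitionsUpTo p n)                           ∎) ⟩
  partitionsUpTo k (p ℕ.+ n) ++ map (p ∷_) (partitionsUpTo p n) ∎
  where
  open ≡.≡-Reasoning
  p : ℕ
  p = suc k
  f g : ℕ → List (List ℕ)
  f m = map (replicate m p ++_) (partitionsUpTo k (p ℕ.+ n ℕ.∸ m ℕ.* p))
  g m = map (replicate m p ++_) (partitionsUpTo k (n ℕ.∸ m ℕ.* p))
  shift : ∀ m → f (suc m) ≡ map (p ∷_) (g m)
  shift m = ≡.trans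
    (≡.cong (λ e → map (replicate (suc m) p ++_) (partitionsUpTo k e)) (ℕₚ.[m+n]∸[m+o]≡n∸o p n (m ℕ.* p)))
    (map-∘ (partitionsUpTo k (n ℕ.∸ m ℕ.* p)))

count : List (List ℕ) → ℕ
count = length ∘ filter (all? allowedPart?)

count-++ : ∀ xs ys → count (xs ++ ys) ≡ count xs ℕ.+ count ys
count-++ xs ys = ≡.trans (≡.cong length (filter-++ (all? allowedPart?) xs ys)) (length-++ (filter (all? allowedPart?) xs))

count-∷ : ∀ p xs → count (map (p ∷_) xs) ≡ (if does (allowedPart? p) then count xs else 0)
count-∷ p []       with does (allowedPart? p)
... | true  = ≡.refl
... | false = ≡.refl
count-∷ p (x ∷ xs) with does (allowedPart? p) | count-∷ p xs
... | false | eq = eq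
... | true  | eq with does (all? allowedPart? x)
...   | true  = ≡.cong suc eq
...   | false = eq

open PowerSeries 𝔽₃

-- The bound `k` on the parts is kept apart from the exponent `n`, so that allowing one more part
-- multiplies the series by one geometric factor.
gf : ℕ → Series
gf k n = count (partitionsUpTo k n) mod 3

gf-0 : ∀ n → gf 0 n ≡ 𝟙 n
gf-0 zero    = ≡.refl
gf-0 (suc n) = ≡.refl

count-< : ∀ k n → n < suc k → count (partitionsUpTo (suc k) n) ≡ count (partitionsUpTo k n)
count-< k n n<1+k = ≡.cong count (partitionsUpTo-< k n n<1+k)

gf-stable : ∀ {k n} → n ≤ k → gf k n ≡ gf n n
gf-stable {k} {n} n≤k = ≡.subst (λ m → gf m n ≡ gf n n) (ℕₚ.m∸n+n≡m n≤k) (go (k ℕ.∸ n))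
  where
  go : ∀ j → gf (j ℕ.+ n) n ≡ gf n n
  go zero    = ≡.refl
  go (suc j) = ≡.trans (≡.cong (_mod 3) (count-< (j ℕ.+ n) n (s≤s (ℕₚ.m≤n+m n j)))) (go j)

module _ (N : ℕ) where
  open CommutativeRing (Truncated N) hiding (zero)
  open Exp commutativeSemiring
  open FiniteJacobi (Truncated N) using (∏)
  open Theta (Truncated N) using (geometric)

  private
    partFactor : ℕ → Series
    partFactor = PartProduct.partFactor 𝔽₃ N 0

  -- Either the part `k + 1` is absent, or it is allowed and removing one copy lowers the exponent
  -- by `k + 1`. For `n ≤ k` the second case is empty, in accordance with the vanishing low
  -- coefficients of `q ^ suc k * gf (suc k)`.
  gf-recurrence : ∀ k → gf (suc k) ≈ gf k + (if does (allowedPart? (suc k)) then q ^ suc k * gf (suc k) else 0#)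
  gf-recurrence k n _ with n ℕₚ.<? suc k
  ... | yes n<1+k = ≡.trans (≡.cong (_mod 3) (count-< k n n<1+k)) (≡.sym (≡.trans (≡.cong (gf k n +₃_) vanish) (K.+-identityʳ _)))
    where
    module K = CommutativeRing 𝔽₃
    vanish : (if does (allowedPart? (suc k)) then q ^ suc k * gf (suc k) else 0#) n ≡ zero
    vanish with does (allowedPart? (suc k))
    ... | true  = q^-⊛-< N (gf (suc k)) (suc k) n n<1+k
    ... | false = ≡.refl
  ... | no n≮1+k = ≡.subst (λ m → gf (suc k) m ≡ gf k m +₃ (if does (allowedPart? (suc k)) then q ^ suc k * gf (suc k) else 0#) m)
                           (ℕₚ.m+[n∸m]≡n (ℕₚ.≮⇒≥ n≮1+k)) (shifted (n ℕ.∸ suc k))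
    where
    shifted : ∀ m → gf (suc k) (suc k ℕ.+ m) ≡
              gf k (suc k ℕ.+ m) +₃ (if does (allowedPart? (suc k)) then q ^ suc k * gf (suc k) else 0#) (suc k ℕ.+ m)
    shifted m = ≡.trans (≡.cong (_mod 3) (≡.trans (≡.cong count (partitionsUpTo-+ k m))
                                                  (count-++ (partitionsUpTo k (suc k ℕ.+ m)) (map (suc k ∷_) (partitionsUpTo (suc k) m)))))
                        (≡.trans (mod-+ (count (partitionsUpTo k (suc k ℕ.+ m))) _) (≡.cong (gf k (suc k ℕ.+ m) +₃_) new))
      where
      new : count (map (suc k ∷_) (partitionsUpTo (suc k) m)) mod 3 ≡
            (if does (allowedPart? (suc k)) then q ^ suc k * gf (suc k) else 0#) (suc k ℕ.+ m)
      new rewrite count-∷ (suc k) (partitionsUpTo (suc k) m) with does (allowedPart? (suc k))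
      ... | true  = ≡.sym (q^-⊛-+ N (gf (suc k)) (suc k) m)
      ... | false = ≡.refl

  gf-step : ∀ k → gf (suc k) * partFactor k ≈ gf k
  gf-step k with does (allowedPart? (suc k)) | gf-recurrence k
  ... | false | rec = trans (*-identityʳ _) (trans rec (+-identityʳ (gf k)))
  ... | true  | rec = geometric rec

  gf-product : ∀ k → gf k * ∏ k partFactor ≈ 1#
  gf-product zero    = trans (*-identityʳ (gf 0)) (λ n _ → gf-0 n)
  gf-product (suc k) = begin
    gf (suc k) * (∏ k partFactor * partFactor k)   ≈⟨ x∙yz≈xz∙y (gf (suc k)) (∏ k partFactor) (partFactor k) ⟩
    gf (suc k) * partFactor k * ∏ k partFactor     ≈⟨ *-congʳ (gf-step k) ⟩
    gf k * ∏ k partFactor                          ≈⟨ gf-product k ⟩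
    1#                                             ∎
    where
    open SetoidReasoning setoid
    open CommutativeSemigroupProperties *-commutativeSemigroup using (x∙yz≈xz∙y)

  -- The bound `12 M` on the parts makes the telescoped product consist of whole periods, as
  -- `∏-partFactor` requires. It also exceeds every `n < N`, so the bounded counts agree with `dp`.
  dp-product : ∀ M → N ≤ M → (λ n → dp n mod 3) * PartProduct.partProduct 𝔽₃ N M ≈ 1#
  dp-product M N≤M = begin
    (λ n → dp n mod 3) * PartProduct.partProduct 𝔽₃ N M    ≈⟨ *-cong {x = λ n → dp n mod 3} (λ n n<N → ≡.sym (gf-stable (n≤12M n<N))) (sym (PartProduct.∏-partFactor 𝔽₃ N M N≤M)) ⟩
    gf (M ℕ.* 12) * ∏ (M ℕ.* 12) partFactor ≈⟨ gf-product (M ℕ.* 12) ⟩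
    1#                                      ∎
    where
    n≤12M : ∀ {n} → n < N → n ≤ M ℕ.* 12
    n≤12M n<N = ℕₚ.≤-trans (ℕₚ.<⇒≤ n<N) (ℕₚ.≤-trans N≤M (ℕₚ.m≤m*n M 12))
    open SetoidReasoning setoid

open import Data.Nat.Base using (_+_; _*_)

theorem1p5 : (n : ℕ) → dp (27 * n + 7) % 3 ≡ dp (3 * n + 1) % 3
theorem1p5 n = begin
  dp (27 * n + 7) % 3                               ≡⟨ toℕ-mod (dp (27 * n + 7)) ⟨
  toℕ (dp (27 * n + 7) mod 3)                       ≡⟨ ≡.cong (λ m → toℕ (dp m mod 3)) index₂₇ ⟩
  -- The argument `≡.refl` proves 1 + (1 + 1) = 0 by evaluation in `𝔽₃`.
  toℕ (section 0 (section 2 (section 1 D)) n)       ≡⟨ ≡.cong toℕ (Congruence.gf-congruence 𝔽₃ ≡.refl D dp-product n) ⟩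
  toℕ (section 1 D n)                               ≡⟨ ≡.cong (λ m → toℕ (dp (m + 1) mod 3)) (ℕₚ.*-comm n 3) ⟩
  toℕ (dp (3 * n + 1) mod 3)                        ≡⟨ toℕ-mod (dp (3 * n + 1)) ⟩
  dp (3 * n + 1) % 3                                  ∎
  where
  open ≡.≡-Reasoning
  D : Series
  D n = dp n mod 3
  index₂₇ : 27 * n + 7 ≡ ((n * 3 + 0) * 3 + 2) * 3 + 1
  index₂₇ = solve 1 (λ n → con 27 :* n :+ con 7 := ((n :* con 3 :+ con 0) :* con 3 :+ con 2) :* con 3 :+ con 1) ≡.refl n
    where open +-*-Solver
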